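{- There exists a kernel of size $2k$ for the $(n-k)$-Discrete problem that can be computed in polynomial time.
   Context: A colored graph $X=(V,E,c)$ is a finite graph with a vertex coloring $c$. Color refinement: initially each vertex $v$ has color $c(v)$; in each round, every vertex is recolored by the tuple consisting of its own color followed by the colors of its neighbors (in color-sorted order); this continues until the partition into color classes becomes stable. Individualizing vertices means assigning them distinct new colors not used elsewhere. A colored graph is discrete if running color refinement on it results in singleton color classes. $(n-k)$-Discrete. Input: a colored graph $X=(V,E,c)$ with $n=|V|$ and an integer $k$. Parameter: $k$. Question: is there a way to individualize all but $k$ vertices (i.e. $n-k$ vertices) of $X$ such that the resulting graph is discrete? A kernel is an instance of the same problem, computed from the given instance $(X,k)$, that is a yes-instance if and only if $(X,k)$ is; its size refers to the number of vertices of its graph, which is at most $2k$ in terms of the parameter $k$ of the given instance. -}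

module Defs where

open import Data.Bool.Base using (Bool; true; false; if_then_else_)
open import Data.Fin.Base using (Fin)
open import Data.Fin.Subset using (Subset; _∈_; _∉_; ∣_∣)
open import Data.List.Base using (List; _∷_; foldr; map; filterᵇ; allFin; tabulate)
import Data.List.Relation.Binary.Lex.NonStrict as Lex
import Data.List.Sort as Sort
open import Data.Nat.Base using (ℕ; zero; suc; _+_; _*_; _^_; _≤_; _<_; _≡ᵇ_)
import Data.Nat.Properties as ℕ
open import Data.Nat.Binary.Base as ℕᵇ using (ℕᵇ; 2[1+_]; 1+[2_])
open import Data.Product.Base using (_×_; _,_; ∃; ∃-syntax)
open import Function.Bundles using (_⇔_)
open import Level using (0ℓ)
open import Relation.Binary.Bundles using (DecTotalOrder)
open import Relation.Binary.PropositionalEquality.Core using (_≡_; _≢_)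
open import Relation.Nullary.Negation.Core using (¬_)

------------------------------------------------------------------------
-- Colored graphs

-- Finite simple undirected graphs with vertex set Fin n, colored by
-- natural numbers.
record ColoredGraph (n : ℕ) : Set where
  field
    adj       : Fin n → Fin n → Bool
    symmetric : ∀ u v → adj u v ≡ adj v u
    loopless  : ∀ v → adj v v ≡ false
    color     : Fin n → ℕ

  neighbors : Fin n → List (Fin n)
  neighbors v = filterᵇ (adj v) (allFin n)

open ColoredGraph public

------------------------------------------------------------------------
-- Color refinement

-- The colors in use after r rounds: natural numbers at the start, and
-- tuples of the previous colors, ordered lexicographically, after that.
colorOrder : ℕ → DecTotalOrder 0ℓ 0ℓ 0ℓ
colorOrder zero    = ℕ.≤-decTotalOrder
colorOrder (suc r) = Lex.≤-decTotalOrder (colorOrder r)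

Color : ℕ → Set
Color r = DecTotalOrder.Carrier (colorOrder r)

module _ {n : ℕ} (X : ColoredGraph n) where

  refine : (r : ℕ) → Fin n → Color r
  refine zero    v = color X v
  refine (suc r) v =
    refine r v ∷ Sort.sort (colorOrder r) (map (refine r) (neighbors X v))

  SameClass : ℕ → Fin n → Fin n → Set
  SameClass r u v = refine r u ≡ refine r v

  -- The (r + 1)-st round leaves the partition into color classes unchanged.
  Stable : ℕ → Set
  Stable r = ∀ u v → SameClass r u v ⇔ SameClass (suc r) u v

  StopsAfter : ℕ → Set
  StopsAfter r = Stable r × (∀ s → s < r → ¬ Stable s)

  Discrete : Set
  Discrete = ∃[ r ] StopsAfter r × (∀ u v → SameClass r u v → u ≡ v)

------------------------------------------------------------------------
-- Individualization and the problem (n-k)-Discrete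

module _ {n : ℕ} where

  recolor : ColoredGraph n → (Fin n → ℕ) → ColoredGraph n
  recolor X c = record
    { adj       = adj X
    ; symmetric = symmetric X
    ; loopless  = loopless X
    ; color     = c
    }

  -- c′ arises from c by giving the vertices in S distinct new colors.
  record Individualizes (c : Fin n → ℕ) (S : Subset n) (c′ : Fin n → ℕ) : Set where
    field
      unchanged : ∀ v → v ∉ S → c′ v ≡ c v
      new       : ∀ v → v ∈ S → ∀ w → c′ v ≢ c w
      distinct  : ∀ u v → u ∈ S → v ∈ S → u ≢ v → c′ u ≢ c′ v

record Instance : Set where
  field
    order : ℕ
    graph : ColoredGraph order
    param : ℕ

open Instance public

-- ∣ S ∣ + k ≡ n says ∣ S ∣ = n - k without truncation; in particular
-- there is no such S when k > n.
YesInstance : Instance → Set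
YesInstance I =
  ∃[ S ] ∃[ c ] ∣ S ∣ + param I ≡ order I
              × Individualizes (color (graph I)) S c
              × Discrete (recolor (graph I) c)

------------------------------------------------------------------------
-- Polynomial time, by the language WHILE of Jones (Computability and
-- Complexity from a Programming Perspective), whose data are binary
-- trees.  With the time measure below it defines the same class of
-- polynomial-time problems as Turing machines.

data Tree : Set where
  nil  : Tree
  cons : Tree → Tree → Tree

size : Tree → ℕ
size nil        = 1
size (cons s t) = suc (size s + size t)

Var : Set
Var = ℕ

data Expr : Set where
  var  : Var → Expr
  nil  : Expr
  cons : Expr → Expr → Expr
  hd   : Expr → Expr
  tl   : Expr → Expr

infixr 5 _⨾_
infix  6 _:=_

data Cmd : Set where
  _:=_            : Var → Expr → Cmd
  _⨾_             : Cmd → Cmd → Cmd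
  test_then_else_ : Expr → Cmd → Cmd → Cmd
  while_run_      : Expr → Cmd → Cmd

Store : Set
Store = Var → Tree

infixl 7 _[_↦_]

_[_↦_] : Store → Var → Tree → Store
(σ [ x ↦ t ]) y = if y ≡ᵇ x then t else σ y

head tail : Tree → Tree
head nil        = nil
head (cons s t) = s
tail nil        = nil
tail (cons s t) = t

eval : Expr → Store → Tree
eval (var x)    σ = σ x
eval nil        σ = nil
eval (cons e f) σ = cons (eval e σ) (eval f σ)
eval (hd e)     σ = head (eval e σ)
eval (tl e)     σ = tail (eval e σ)

-- Every operator costs one step: trees are passed by reference, and
-- there is no operation that compares whole trees.
cost : Expr → ℕ
cost (var x)    = 1
cost nil        = 1
cost (cons e f) = suc (cost e + cost f)
cost (hd e)     = suc (cost e)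
cost (tl e)     = suc (cost e)

-- ⟨ p , σ ⟩⇓ τ ∣ t : started in the store σ, the command p terminates in
-- the store τ after t steps.  As a condition, nil is false and all else is true.
infix 3 ⟨_,_⟩⇓_∣_

data ⟨_,_⟩⇓_∣_ : Cmd → Store → Store → ℕ → Set where

  assign : ∀ {x e σ} →
           ⟨ x := e , σ ⟩⇓ σ [ x ↦ eval e σ ] ∣ suc (cost e)

  seq    : ∀ {p q σ τ υ s t} →
           ⟨ p , σ ⟩⇓ τ ∣ s →
           ⟨ q , τ ⟩⇓ υ ∣ t →
           ⟨ p ⨾ q , σ ⟩⇓ υ ∣ s + t

  then-  : ∀ {e p q σ τ t a b} →
           eval e σ ≡ cons a b →
           ⟨ p , σ ⟩⇓ τ ∣ t →
           ⟨ test e then p else q , σ ⟩⇓ τ ∣ suc (cost e + t)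

  else-  : ∀ {e p q σ τ t} →
           eval e σ ≡ nil →
           ⟨ q , σ ⟩⇓ τ ∣ t →
           ⟨ test e then p else q , σ ⟩⇓ τ ∣ suc (cost e + t)

  stop   : ∀ {e p σ} →
           eval e σ ≡ nil →
           ⟨ while e run p , σ ⟩⇓ σ ∣ suc (cost e)

  loop   : ∀ {e p σ τ υ s t a b} →
           eval e σ ≡ cons a b →
           ⟨ p , σ ⟩⇓ τ ∣ s →
           ⟨ while e run p , τ ⟩⇓ υ ∣ t →
           ⟨ while e run p , σ ⟩⇓ υ ∣ suc (cost e + (s + t))

-- Input and output are in variable 0; the others are initially nil.
initial : Tree → Store
initial t = (λ _ → nil) [ 0 ↦ t ]

-- The output is bounded as well as the time because, with sharing of
-- subtrees, few steps can build a very large tree.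
PolynomialTime : {A B : Set} → (A → Tree) → (B → Tree) → (A → B) → Set
PolynomialTime {A} encA encB f =
  ∃[ p ] ∃[ a ] ∃[ d ] ∀ (x : A) →
    ∃[ τ ] ∃[ t ] ⟨ p , initial (encA x) ⟩⇓ τ ∣ t
                × τ 0 ≡ encB (f x)
                × t ≤ a * size (encA x) ^ d
                × size (τ 0) ≤ a * size (encA x) ^ d

------------------------------------------------------------------------
-- Encoding of instances

encodeList : {A : Set} → (A → Tree) → List A → Tree
encodeList enc = foldr (λ x t → cons (enc x) t) nil

encodeBool : Bool → Tree
encodeBool false = nil
encodeBool true  = cons nil nil

-- Numbers are written in (bijective) binary, least significant digit first,
-- so that the size of the encoding is logarithmic.
encodeℕᵇ : ℕᵇ → Tree
encodeℕᵇ ℕᵇ.zero  = nil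
encodeℕᵇ 2[1+ b ] = cons (encodeBool false) (encodeℕᵇ b)
encodeℕᵇ 1+[2 b ] = cons (encodeBool true) (encodeℕᵇ b)

encodeℕ : ℕ → Tree
encodeℕ n = encodeℕᵇ (ℕᵇ.fromℕ n)

-- The parameter, the list of colors and the adjacency matrix by rows.
encode : Instance → Tree
encode I =
  cons (encodeℕ (param I))
    (cons (encodeList encodeℕ (tabulate (color (graph I))))
          (encodeList (encodeList encodeBool)
                      (tabulate λ u → tabulate λ v → adj (graph I) u v)))

------------------------------------------------------------------------
-- Kernelizations

-- The size of the kernel is its number of vertices, bounded in terms of
-- the parameter of the given instance.
record Kernelization (size-bound : ℕ → ℕ) (κ : Instance → Instance) : Set where
  field
    equivalent : ∀ I → YesInstance I ⇔ YesInstance (κ I)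
    bounded    : ∀ I → order (κ I) ≤ size-bound (param I)

{-# OPTIONS --safe #-}

-- Two equally colored vertices are twins if they have the same neighbors
-- apart from each other.  An automorphism exchanges them, so at most one
-- vertex of a twin class is spared from individualization, and any of them
-- can be the one.  All others are individualized; such a vertex matters to
-- color refinement only through its adjacencies, so it may be deleted once
-- these are recorded in the colors of the remaining vertices.
--
-- The remaining graph has no twins.  In such a graph individualizing a vertex
-- of a nontrivial class creates at least two new classes, for if the class
-- only lost that vertex, it would consist of twins.  Hence it is enough to
-- individualize half of the vertices, and with at least 2k vertices the
-- answer is yes.

module Submission where

open import Defs
open import Data.Bool.Base using (Bool; T; _∧_; _∨_; false; if_then_else_; not; true)
open import Data.Bool.ListAction using (all; any)
import Data.Bool.Properties as Bool
open import Data.Bool.Properties using (T-∧; T-∨; T-≡; T?)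
open import Data.Fin.Base using (Fin; _>_; suc; toℕ; zero)
open import Data.Fin.Induction using (>-wellFounded)
import Data.Fin.Properties as Fin
open import Data.Fin.Subset as Subset using (Subset; _∪_; ⁅_⁆; ∣_∣)
import Data.Fin.Subset.Properties as Subset
open import Data.List.Base using (List; []; _++_; _∷_; allFin; drop; filter; filterᵇ; foldl; foldr; length; lookup; map; replicate; reverse; tabulate; take)
import Data.List.Membership.DecPropositional as Dec∈
open import Data.List.Membership.Propositional using (_∈_; _∉_; find; lose)
open import Data.List.Membership.Propositional.Properties using (∈-++⁺ʳ; ∈-++⁺ˡ; ∈-++⁻; ∈-AllPairs₂; ∈-allFin; ∈-filter⁺; ∈-filter⁻; ∈-lookup; ∈-map⁺; ∈-map⁻; ∈-∃++)
open import Data.List.Membership.Propositional.Properties.WithK using (unique∧set⇒bag)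
import Data.List.Properties as List
open import Data.List.Relation.Binary.BagAndSetEquality using (∼bag⇒↭)
open import Data.List.Relation.Binary.Permutation.Homogeneous as Homogeneous using (Permutation; prep)
open import Data.List.Relation.Binary.Permutation.Propositional using (_↭_; ↭-prep; ↭-refl; ↭-sym; ↭-trans; ↭ₛ⇒↭; ↭⇒↭ₛ)
import Data.List.Relation.Binary.Permutation.Propositional.Properties as ↭
import Data.List.Relation.Binary.Permutation.Setoid.Properties as Permutationₛ
open import Data.List.Relation.Binary.Pointwise as Pointwise using (Pointwise; Pointwise-≡⇒≡; []; _∷_; ≡⇒Pointwise-≡)
open import Data.List.Relation.Binary.Subset.Propositional using (_⊆_)
open import Data.List.Relation.Unary.All as All using (All; []; _∷_)
import Data.List.Relation.Unary.All.Properties as All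
open import Data.List.Relation.Unary.AllPairs as AllPairs using (AllPairs; []; _∷_)
open import Data.List.Relation.Unary.Any as Any using (Any; here; there)
import Data.List.Relation.Unary.Any.Properties as Any
import Data.List.Relation.Unary.Sorted.TotalOrder.Properties as Sorted
open import Data.List.Relation.Unary.Unique.Propositional using (Unique)
import Data.List.Relation.Unary.Unique.Propositional.Properties as Unique
import Data.List.Sort as Sort
open import Data.Nat using (NonZero; _*_; _+_; _<_; _<ᵇ_; _^_; _∸_; _≡ᵇ_; _≤_; _⊔_; pred; suc; s≤s; zero; z≤n; ℕ; ⌊_/2⌋)
open import Data.Nat.Binary.Base as ℕᵇ using (1+[2_]; 2[1+_]; ℕᵇ)
import Data.Nat.Binary.Properties as ℕᵇ
import Data.Nat.Properties as ℕ
open import Data.Product using (_,_; _×_; proj₁; proj₂; Σ; ∃-syntax; Σ-syntax)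
open import Data.Sum using (_⊎_; inj₁; inj₂)
open import Data.Unit.Base using (tt; ⊤)
import Data.Vec.Base as Vec
open import Data.Vec.Base using ([]; _∷_)
import Data.Vec.Properties as Vec
open import Function.Base using (_∘_; flip; id)
open import Function.Bundles using (Equivalence; _⇔_; mk⇔)
open import Induction.WellFounded using (Acc; acc)
open import Level using (0ℓ)
open import Relation.Binary using (DecTotalOrder; Decidable; DecidableEquality; IsEquivalence; Rel; Setoid; tri<; tri>; tri≈)
import Relation.Binary.PropositionalEquality as ≡
open import Relation.Binary.PropositionalEquality hiding (isEquivalence; setoid; J)
open import Relation.Nullary using (contradiction; no; yes; ¬_)
open import Relation.Nullary.Decidable using (_×-dec_; _⊎-dec_; decidable-stable; does; does-⇔; ¬?)

-- Rounds and tuple colors are hard to compare between different graphs, so they are eliminated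
-- first. The stable partition is the coarsest `Equitable` relation, and individualizing a set only
-- restricts attention to those relations in which its vertices are singletons. Two graphs or two
-- sets are then compared by transporting an equitable relation: along an automorphism, by
-- restriction to the kept vertices, or by extension with singletons. The problem is restated for
-- the list of the k spared vertices. They can be exchanged for kept ones, so deletion preserves
-- their number and the parameter need not change. A deleted vertex contributes just one binary
-- digit to a color, which keeps the new colors short. The parameter is given in binary and may be
-- exponentially large compared with the graph, so no program may count up to it: it is read digit
-- by digit and compared with half the number of kept vertices. Every program combinator carries
-- polynomial bounds for time and output size together, as the time of a later program depends on
-- the size of what it is given.

agree : Bool → Bool → Bool
agree b c = if b then c else not c

-- This adds a least significant digit in bijective binary, which in the
-- encoding of numbers is a single cons.
prependBit : Bool → ℕ → ℕ
prependBit b c = if b then suc (2 * c) else 2 * suc c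

module _ {n : ℕ} (X : ColoredGraph n) where

  areTwins : Fin n → Fin n → Bool
  areTwins u v = (color X u ≡ᵇ color X v) ∧
    all (λ w → (toℕ w ≡ᵇ toℕ u) ∨ ((toℕ w ≡ᵇ toℕ v) ∨ agree (adj X u w) (adj X v w))) (allFin n)

  -- The survivor of a twin class is its last vertex, which can be recognized without forming the
  -- classes.
  isKept : Fin n → Bool
  isKept u = not (any (λ v → (toℕ u <ᵇ toℕ v) ∧ areTwins u v) (allFin n))

  kept : List (Fin n)
  kept = filterᵇ isKept (allFin n)

  -- A deleted vertex counts as individualized, so all that is left of it is
  -- the distinction it makes between its neighbors and the other vertices.
  newColor : Fin n → ℕ
  newColor v = foldr (λ u c → if isKept u then c else prependBit (adj X u v) c) (color X v) (allFin n)

  twinFree : ColoredGraph (length kept)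
  twinFree = record
    { adj       = λ i j → adj X (lookup kept i) (lookup kept j)
    ; symmetric = λ i j → symmetric X (lookup kept i) (lookup kept j)
    ; loopless  = λ i → loopless X (lookup kept i)
    ; color     = λ i → newColor (lookup kept i)
    }

-- The parameter of `reduced` stays k because it counts spared vertices, while deletion concerns
-- individualized ones. The empty graph with parameter 0 serves as a constant yes-instance.
trivial reduced κ : Instance → Instance
trivial I = record
  { order = 0
  ; graph = record { adj = λ () ; symmetric = λ () ; loopless = λ () ; color = λ () }
  ; param = 0
  }
reduced I = record { graph = twinFree (graph I) ; param = param I }

-- With m kept vertices the test is 2k ≤ m. Halving m instead of doubling k avoids arithmetic on the
-- binary parameter.
κ I = if param I <ᵇ suc ⌊ length (kept (graph I)) /2⌋ then trivial I else reduced I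

-- Color refinement and equitable partitions

-- `balanced` means that u and v have equally many neighbors in every class. A matching of the
-- neighbor lists expresses this without counting and is easily transported along maps of vertices.
record Equitable {n} (X : ColoredGraph n) (E : Rel (Fin n) 0ℓ) : Set where
  field
    isEquivalence : IsEquivalence E
    sameColor     : ∀ {u v} → E u v → color X u ≡ color X v
    balanced      : ∀ {u v} → E u v → Permutation E (neighbors X u) (neighbors X v)

  module Eq = IsEquivalence isEquivalence

  setoid : Setoid 0ℓ 0ℓ
  setoid = record { isEquivalence = isEquivalence }

≈⇒≡ : ∀ r {c d} → DecTotalOrder._≈_ (colorOrder r) c d → c ≡ d
≈⇒≡ zero    eq = eq
≈⇒≡ (suc r) eq = Pointwise-≡⇒≡ (Pointwise.map (≈⇒≡ r) eq)

color-≟ : ∀ r → DecidableEquality (Color r)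
color-≟ zero    = ℕ._≟_
color-≟ (suc r) = List.≡-dec (color-≟ r)

module _ (r : ℕ) where

  private
    module O = DecTotalOrder (colorOrder r)
    open Sort (colorOrder r)

  ↭⇒sort≡ : ∀ {cs ds} → cs ↭ ds → sort cs ≡ sort ds
  ↭⇒sort≡ {cs} {ds} cs↭ds = ≈⇒≡ (suc r) (Sorted.↗↭↗⇒≋ O.totalOrder (sort-↗ cs) (sort-↗ ds)
    (Homogeneous.map O.Eq.reflexive (↭⇒↭ₛ (↭-trans (sort-↭ cs) (↭-trans cs↭ds (↭-sym (sort-↭ ds)))))))

  sort≡⇒↭ : ∀ {cs ds} → sort cs ≡ sort ds → cs ↭ ds
  sort≡⇒↭ {cs} {ds} eq = ↭-trans (↭-sym (sort-↭ cs)) (subst (_↭ ds) (sym eq) (sort-↭ ds))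

Unique-⊆⇒length≤ : ∀ {A : Set} {xs ys : List A} → Unique xs → xs ⊆ ys → length xs ≤ length ys
Unique-⊆⇒length≤ {xs = []} [] xs⊆ys = z≤n
Unique-⊆⇒length≤ {xs = x ∷ xs} (x∉xs ∷ unique) xs⊆ys with ∈-∃++ (xs⊆ys (here refl))
... | as , bs , refl = begin
  suc (length xs)         ≤⟨ s≤s (Unique-⊆⇒length≤ unique without) ⟩
  suc (length (as ++ bs)) ≡⟨ cong suc (List.length-++ as) ⟩
  suc (length as + length bs) ≡⟨ ℕ.+-suc (length as) (length bs) ⟨
  length as + suc (length bs) ≡⟨ List.length-++ as ⟨
  length (as ++ x ∷ bs) ∎
  where
  open ℕ.≤-Reasoning
  without : xs ⊆ as ++ bs
  without y∈xs with ∈-++⁻ as (xs⊆ys (there y∈xs))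
  ... | inj₁ y∈as         = ∈-++⁺ˡ y∈as
  ... | inj₂ (here refl)  = contradiction refl (All.lookup x∉xs y∈xs)
  ... | inj₂ (there y∈bs) = ∈-++⁺ʳ as y∈bs

-- Representatives of distinct classes: the length of such a list is a lower bound for the number of
-- classes, with no need to form the quotient. Termination of color refinement and the count of
-- classes in twin-free graphs both rest on letting it grow.
Separated : ∀ {n} → Rel (Fin n) 0ℓ → List (Fin n) → Set
Separated E = AllPairs (λ u v → ¬ E u v)

separated-length : ∀ {n} {E : Rel (Fin n) 0ℓ} → IsEquivalence E → ∀ {T} → Separated E T → length T ≤ n
separated-length {n} {E} equiv {T} separated = ℕ.≤-trans
  (Unique-⊆⇒length≤ (AllPairs.map (λ ¬uv u≡v → ¬uv (IsEquivalence.reflexive equiv u≡v)) separated) (λ {x} _ → ∈-allFin x))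
  (ℕ.≤-reflexive (List.length-tabulate id))

module _ {n} {E E′ : Rel (Fin n) 0ℓ} (equiv : IsEquivalence E) (equiv′ : IsEquivalence E′)
         (E′⇒E : ∀ {u v} → E′ u v → E u v) (E? : Decidable E) (E′? : Decidable E′) where

  private
    module E  = IsEquivalence equiv
    module E′ = IsEquivalence equiv′

  -- `T` has at most one member in the `E`-class of x and y. As `E′` separates x from y, that member
  -- is `E′`-unrelated to one of them, which can therefore be added.
  separated-extend : ∀ {T x y} → Separated E T → E x y → ¬ E′ x y → ∃[ z ] Separated E′ (z ∷ T)
  separated-extend {T} {x} {y} separated xy ¬xy with Any.any? (E′? x) T
  ... | no ¬any = x , All.tabulate (λ s∈T xs → ¬any (Any.map (λ { refl → xs }) s∈T)) ∷ AllPairs.map (_∘ E′⇒E) separated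
  ... | yes any = let t , t∈T , xt = find any in y , All.tabulate (apart t∈T xt) ∷ AllPairs.map (_∘ E′⇒E) separated
    where
    apart : ∀ {t s} → t ∈ T → E′ x t → s ∈ T → ¬ E′ y s
    apart t∈T xt s∈T ys with ∈-AllPairs₂ separated s∈T t∈T
    ... | inj₁ refl = ¬xy (E′.trans xt (E′.sym ys))
    ... | inj₂ (inj₁ ¬st) = ¬st (E.trans (E.sym (E′⇒E ys)) (E.trans (E.sym xy) (E′⇒E xt)))
    ... | inj₂ (inj₂ ¬ts) = ¬ts (E.trans (E.sym (E′⇒E xt)) (E.trans xy (E′⇒E ys)))

  separate-or-equal : (∃[ x ] ∃[ y ] E x y × ¬ E′ x y) ⊎ (∀ {x y} → E x y → E′ x y)
  separate-or-equal with Fin.any? (λ x → Fin.any? (λ y → E? x y ×-dec ¬? (E′? x y)))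
  ... | yes (x , y , split) = inj₁ (x , y , split)
  ... | no  ¬split = inj₂ (λ {x} {y} xy → decidable-stable (E′? x y) (λ ¬xy → ¬split (x , y , xy , ¬xy)))

-- Color refinement computes the coarsest equitable partition

module _ {n} (X : ColoredGraph n) where

  sameClass-isEquivalence : ∀ r → IsEquivalence (SameClass X r)
  sameClass-isEquivalence r = record { refl = refl ; sym = sym ; trans = trans }

  sameClass? : ∀ r → Decidable (SameClass X r)
  sameClass? r u v = color-≟ r (refine X r u) (refine X r v)

  sameClass-down : ∀ r {u v} → SameClass X (suc r) u v → SameClass X r u v
  sameClass-down r = List.∷-injectiveˡ

  sameClass-color : ∀ r {u v} → SameClass X r u v → color X u ≡ color X v
  sameClass-color zero    uv = uv
  sameClass-color (suc r) uv = sameClass-color r (sameClass-down r uv)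

  -- Equal sorted lists give a permutation of colors, which lifts to the vertices: a reordering of
  -- the first neighborhood, followed by a pointwise match of equal colors.
  sameClass-balanced : ∀ r {u v} → SameClass X (suc r) u v →
                       Permutation (SameClass X r) (neighbors X u) (neighbors X v)
  sameClass-balanced r {u} {v} uv with ↭.↭-map-inv (refine X r) (sort≡⇒↭ r (List.∷-injectiveʳ uv))
  ... | ws , eq , Nu↭ws = Homogeneous.trans
    (Homogeneous.map (cong (refine X r)) (↭⇒↭ₛ Nu↭ws))
    (Homogeneous.refl (Pointwise.map⁻ _ _ (≡⇒Pointwise-≡ (sym eq))))

  stable⇒equitable : ∀ r → Stable X r → Equitable X (SameClass X r)
  stable⇒equitable r stable = record
    { isEquivalence = sameClass-isEquivalence r
    ; sameColor     = sameClass-color r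
    ; balanced      = λ {u} {v} uv → sameClass-balanced r (Equivalence.to (stable u v) uv)
    }

  -- No round can split an equitable partition: matched neighbors of related vertices have equal
  -- colors by induction, so the sorted tuples agree.
  equitable⇒sameClass : ∀ {E} → Equitable X E → ∀ r {u v} → E u v → SameClass X r u v
  equitable⇒sameClass equitable zero    uv = Equitable.sameColor equitable uv
  equitable⇒sameClass equitable (suc r) uv = cong₂ _∷_ (equitable⇒sameClass equitable r uv)
    (↭⇒sort≡ r (↭ₛ⇒↭ (Permutationₛ.map⁺ (Equitable.setoid equitable) (≡.setoid (Color r))
      (equitable⇒sameClass equitable r) (Equitable.balanced equitable uv))))

  -- An unstable round splits a class and so lengthens a list of representatives, which can happen
  -- at most n times. The rounds are tried in order, hence the one found is the first that is
  -- stable.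
  stops : ∃[ r ] StopsAfter X r
  stops = search (suc n) 0 (ℕ.+-identityʳ (suc n)) (λ _ ()) [] ℕ.≤-refl []
    where
    search : ∀ fuel r → fuel + r ≡ suc n → (∀ s → s < r → ¬ Stable X s) →
             ∀ T → r ≤ length T → Separated (SameClass X r) T → ∃[ r ] StopsAfter X r
    search zero r refl _ T r≤ separated = contradiction
      (ℕ.≤-trans r≤ (separated-length (sameClass-isEquivalence r) separated)) (ℕ.<-irrefl refl)
    search (suc fuel) r eq unstable T r≤ separated
      with separate-or-equal (sameClass-isEquivalence r) (sameClass-isEquivalence (suc r))
             (sameClass-down r) (sameClass? r) (sameClass? (suc r))
    ... | inj₂ equal = r , (λ u v → mk⇔ equal (sameClass-down r)) , unstable
    ... | inj₁ (x , y , xy , ¬xy) =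
      let z , separated′ = separated-extend (sameClass-isEquivalence r) (sameClass-isEquivalence (suc r))
                             (sameClass-down r) (sameClass? r) (sameClass? (suc r)) separated xy ¬xy
      in search fuel (suc r) (trans (ℕ.+-suc fuel r) eq) unstable′ (z ∷ T) (s≤s r≤) separated′
      where
      unstable′ : ∀ s → s < suc r → ¬ Stable X s
      unstable′ s (s≤s s≤r) stable with ℕ.m≤n⇒m<n∨m≡n s≤r
      ... | inj₁ s<r  = unstable s s<r stable
      ... | inj₂ refl = ¬xy (Equivalence.to (stable x y) xy)

  record Coarsest : Set₁ where
    field
      E         : Rel (Fin n) 0ℓ
      E?        : Decidable E
      equitable : Equitable X E
      coarsest  : ∀ {E′} → Equitable X E′ → ∀ {u v} → E′ u v → E u v

  coarsestEquitable : Coarsest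
  coarsestEquitable = let r , stable , _ = stops in record
    { E         = SameClass X r
    ; E?        = sameClass? r
    ; equitable = stable⇒equitable r stable
    ; coarsest  = λ equitable → equitable⇒sameClass equitable r
    }

  -- Discreteness freed of rounds: the stable partition is itself equitable and contains every
  -- equitable relation, so it is trivial exactly if all of them are.
  Rigid : Set₁
  Rigid = ∀ E → Equitable X E → ∀ {u v} → E u v → u ≡ v

  discrete⇒rigid : Discrete X → Rigid
  discrete⇒rigid (r , _ , injective) E equitable uv = injective _ _ (equitable⇒sameClass equitable r uv)

  rigid⇒discrete : Rigid → Discrete X
  rigid⇒discrete rigid = let r , stopped = stops in
    r , stopped , λ u v → rigid (SameClass X r) (stable⇒equitable r (proj₁ stopped))

-- Individualization

SingledOut : ∀ {n} → (Fin n → Set) → Rel (Fin n) 0ℓ → Set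
SingledOut P E = ∀ {x y} → P x → E x y → x ≡ y

module _ {n} {X : ColoredGraph n} {S : Subset n} {c : Fin n → ℕ} (individualizes : Individualizes (color X) S c) where

  open Individualizes individualizes

  -- Together with its converse below, this makes the choice of the new colors immaterial: their
  -- only effect on equitable relations is to turn the vertices of `S` into singletons.
  recolor-equitable⁻ : ∀ {E} → Equitable (recolor X c) E → Equitable X E × SingledOut (Subset._∈ S) E
  recolor-equitable⁻ {E} equitable = record
    { isEquivalence = isEquivalence
    ; sameColor     = original
    ; balanced      = balanced
    } , single
    where
    open Equitable equitable

    single : SingledOut (Subset._∈ S) E
    single {x} {y} x∈S xy with y Subset.∈? S | x Fin.≟ y
    ... | _       | yes x≡y = x≡y
    ... | yes y∈S | no  x≢y = contradiction (sameColor xy) (distinct x y x∈S y∈S x≢y)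
    ... | no  y∉S | no  _   = contradiction (trans (sameColor xy) (unchanged y y∉S)) (new x x∈S y)

    original : ∀ {u v} → E u v → color X u ≡ color X v
    original {u} {v} uv with u Subset.∈? S | v Subset.∈? S
    ... | yes u∈S | _       = cong (color X) (single u∈S uv)
    ... | no  _   | yes v∈S = sym (cong (color X) (single v∈S (Eq.sym uv)))
    ... | no  u∉S | no  v∉S = trans (sym (unchanged u u∉S)) (trans (sameColor uv) (unchanged v v∉S))

  recolor-equitable⁺ : ∀ {E} → Equitable X E → SingledOut (Subset._∈ S) E → Equitable (recolor X c) E
  recolor-equitable⁺ {E} equitable single = record
    { isEquivalence = isEquivalence
    ; sameColor     = recolored
    ; balanced      = balanced
    }
    where
    open Equitable equitable

    recolored : ∀ {u v} → E u v → c u ≡ c v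
    recolored {u} {v} uv with u Subset.∈? S | v Subset.∈? S
    ... | yes u∈S | _       = cong c (single u∈S uv)
    ... | no  _   | yes v∈S = sym (cong c (single v∈S (Eq.sym uv)))
    ... | no  u∉S | no  v∉S = trans (unchanged u u∉S) (trans (sameColor uv) (sym (unchanged v v∉S)))

upperBound : ∀ {n} (f : Fin n → ℕ) → ∃[ m ] (∀ v → f v ≤ m)
upperBound {zero}  f = 0 , λ ()
upperBound {suc n} f = let m , ≤m = upperBound (f ∘ suc) in
  f zero ⊔ m , λ { zero → ℕ.m≤m⊔n _ _ ; (suc v) → ℕ.m≤n⇒m≤o⊔n (f zero) (≤m v) }

individualization : ∀ {n} (c : Fin n → ℕ) (S : Subset n) → ∃[ c′ ] Individualizes c S c′
individualization {n} c S = c′ , record { unchanged = unchanged ; new = new ; distinct = distinct }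
  where
  m = proj₁ (upperBound c)

  c′ : Fin n → ℕ
  c′ v with v Subset.∈? S
  -- Colors above the maximum `m` of the old ones are new, and the offset by the vertex number makes
  -- them distinct.
  ... | yes _ = suc (m + toℕ v)
  ... | no  _ = c v

  unchanged : ∀ v → v Subset.∉ S → c′ v ≡ c v
  unchanged v v∉S with v Subset.∈? S
  ... | yes v∈S = contradiction v∈S v∉S
  ... | no  _   = refl

  value : ∀ v → v Subset.∈ S → c′ v ≡ suc (m + toℕ v)
  value v v∈S with v Subset.∈? S
  ... | yes _   = refl
  ... | no  v∉S = contradiction v∈S v∉S

  new : ∀ v → v Subset.∈ S → ∀ w → c′ v ≢ c w
  new v v∈S w eq = ℕ.<⇒≢ (s≤s (ℕ.≤-trans (proj₂ (upperBound c) w) (ℕ.m≤m+n m (toℕ v)))) (trans (sym eq) (value v v∈S))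

  distinct : ∀ u v → u Subset.∈ S → v Subset.∈ S → u ≢ v → c′ u ≢ c′ v
  distinct u v u∈S v∈S u≢v eq = u≢v (Fin.toℕ-injective (ℕ.+-cancelˡ-≡ m _ _ (ℕ.suc-injective
    (trans (sym (value u u∈S)) (trans eq (value v v∈S))))))

-- Individualizing all vertices outside of the list W makes the graph discrete.
Determined : ∀ {n} → ColoredGraph n → List (Fin n) → Set₁
Determined X W = ∀ E → Equitable X E → SingledOut (_∉ W) E → ∀ {u v} → E u v → u ≡ v

-- Sparing fewer vertices singles out more of them, which leaves fewer relations to be trivial.
Determined-⊆ : ∀ {n} {X : ColoredGraph n} {V W} → V ⊆ W → Determined X W → Determined X V
Determined-⊆ V⊆W determined E equitable single =
  determined E equitable (λ x∉W → single (x∉W ∘ V⊆W))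

∣tabulate∣+filter-not : ∀ {n} {A : Set} (p : A → Bool) (f : Fin n → A) →
                        ∣ Vec.tabulate (p ∘ f) ∣ + length (filterᵇ (not ∘ p) (tabulate f)) ≡ n
∣tabulate∣+filter-not {zero}  p f = refl
∣tabulate∣+filter-not {suc n} p f with p (f zero)
... | true  = cong suc (∣tabulate∣+filter-not p (f ∘ suc))
... | false = trans (ℕ.+-suc _ _) (cong suc (∣tabulate∣+filter-not p (f ∘ suc)))

∈-filterᵇ⁻ : ∀ {A : Set} (p : A → Bool) {xs x} → x ∈ filterᵇ p xs → x ∈ xs × p x ≡ true
∈-filterᵇ⁻ p x∈ = let x∈xs , px = ∈-filter⁻ (T? ∘ p) x∈ in x∈xs , Equivalence.to T-≡ px

∈-filterᵇ⁺ : ∀ {A : Set} (p : A → Bool) {xs x} → x ∈ xs → p x ≡ true → x ∈ filterᵇ p xs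
∈-filterᵇ⁺ p x∈xs px = ∈-filter⁺ (T? ∘ p) x∈xs (Equivalence.from T-≡ px)

Unique-filterᵇ : ∀ {A : Set} (p : A → Bool) {xs} → Unique xs → Unique (filterᵇ p xs)
Unique-filterᵇ p = Unique.filter⁺ (T? ∘ p)

-- `W` lists the k spared vertices and not the n - k individualized ones: only the former can be
-- carried over to the kernel unchanged in number.
Solvable : Instance → Set₁
Solvable I = Σ[ W ∈ List (Fin (order I)) ] Unique W × length W ≡ param I × Determined (graph I) W

yes⇒solvable : ∀ I → YesInstance I → Solvable I
yes⇒solvable I (S , c , total , individualizes , discrete) = W , Unique-filterᵇ outside (Unique.allFin⁺ _) , length≡ , determined
  where
  outside : Fin (order I) → Bool
  outside = not ∘ Vec.lookup S

  W = filterᵇ outside (allFin (order I))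

  length≡ : length W ≡ param I
  length≡ = ℕ.+-cancelˡ-≡ ∣ S ∣ _ _ (trans
    (subst (λ S′ → ∣ S′ ∣ + length W ≡ order I) (Vec.tabulate∘lookup S) (∣tabulate∣+filter-not (Vec.lookup S) id)) (sym total))

  determined : Determined (graph I) W
  determined E equitable single = discrete⇒rigid _ discrete E (recolor-equitable⁺ individualizes equitable
    (λ x∈S → single (λ x∈W → contradiction (trans (sym (cong not (Vec.[]=⇒lookup x∈S))) (proj₂ (∈-filterᵇ⁻ outside {allFin (order I)} x∈W))) (λ ()))))

solvable⇒yes : ∀ I → Solvable I → YesInstance I
solvable⇒yes I (W , unique , length≡ , determined) = S , proj₁ individualized , total , proj₂ individualized ,
  rigid⇒discrete _ (λ E equitable → let equitable′ , single = recolor-equitable⁻ (proj₂ individualized) equitable in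
    determined E equitable′ (λ x∉W → single (∉W⇒∈S x∉W)))
  where
  open Dec∈ (Fin._≟_ {order I}) using (_∈?_)

  outside : Fin (order I) → Bool
  outside v = not (does (v ∈? W))

  S = Vec.tabulate outside

  ∉W⇒∈S : ∀ {x} → x ∉ W → x Subset.∈ S
  ∉W⇒∈S {x} x∉W = Vec.lookup⇒[]= x S (trans (Vec.lookup∘tabulate outside x) eq)
    where
    eq : outside x ≡ true
    eq with x ∈? W
    ... | yes x∈W = contradiction x∈W x∉W
    ... | no  _   = refl

  individualized = individualization (color (graph I)) S

  inside : List (Fin (order I))
  inside = filterᵇ (not ∘ outside) (allFin (order I))

  inside⊆W : inside ⊆ W
  inside⊆W {x} x∈ with x ∈? W | proj₂ (∈-filterᵇ⁻ (not ∘ outside) {allFin (order I)} x∈)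
  ... | yes x∈W | _ = x∈W
  ... | no  _   | ()

  W⊆inside : W ⊆ inside
  W⊆inside {x} x∈W = ∈-filterᵇ⁺ (not ∘ outside) (∈-allFin x) eq
    where
    eq : not (outside x) ≡ true
    eq with x ∈? W
    ... | yes _   = refl
    ... | no  x∉W = contradiction x∈W x∉W

  total : ∣ S ∣ + param I ≡ order I
  total = trans (cong (∣ S ∣ +_) (trans (sym length≡) (ℕ.≤-antisym (Unique-⊆⇒length≤ unique W⊆inside)
           (Unique-⊆⇒length≤ (Unique-filterᵇ (not ∘ outside) (Unique.allFin⁺ _)) inside⊆W))))
    (∣tabulate∣+filter-not outside id)

-- Twins

Unique-neighbors : ∀ {n} (X : ColoredGraph n) u → Unique (neighbors X u)
Unique-neighbors X u = Unique-filterᵇ (adj X u) (Unique.allFin⁺ _)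

∈-neighbors⁺ : ∀ {n} (X : ColoredGraph n) {u v} → adj X u v ≡ true → v ∈ neighbors X u
∈-neighbors⁺ X {u} {v} = ∈-filterᵇ⁺ (adj X u) (∈-allFin v)

∈-neighbors⁻ : ∀ {n} (X : ColoredGraph n) {u v} → v ∈ neighbors X u → adj X u v ≡ true
∈-neighbors⁻ {n} X {u} v∈ = proj₂ (∈-filterᵇ⁻ (adj X u) {allFin n} v∈)

record Twins {n} (X : ColoredGraph n) (u v : Fin n) : Set where
  constructor mkTwins
  field
    sameColor : color X u ≡ color X v
    sameAdj   : ∀ w → w ≢ u → w ≢ v → adj X u w ≡ adj X v w

module _ {n} (X : ColoredGraph n) where

  agree⇒≡ : ∀ a b → T (agree a b) → a ≡ b
  agree⇒≡ true  true  _ = refl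
  agree⇒≡ false false _ = refl

  ≡⇒agree : ∀ a b → a ≡ b → T (agree a b)
  ≡⇒agree true  true  _ = _
  ≡⇒agree false false _ = _

  areTwins⇒Twins : ∀ {u v} → T (areTwins X u v) → Twins X u v
  areTwins⇒Twins {u} {v} twins with Equivalence.to T-∧ twins
  ... | colors , adjs = mkTwins (ℕ.≡ᵇ⇒≡ _ _ colors) same
    where
    same : ∀ w → w ≢ u → w ≢ v → adj X u w ≡ adj X v w
    same w w≢u w≢v with Equivalence.to T-∨ (All.lookup (All.all⁺ _ (allFin n) adjs) (∈-allFin w))
    ... | inj₁ w≡u = contradiction (Fin.toℕ-injective (ℕ.≡ᵇ⇒≡ _ _ w≡u)) w≢u
    ... | inj₂ or with Equivalence.to T-∨ or
    ...   | inj₁ w≡v = contradiction (Fin.toℕ-injective (ℕ.≡ᵇ⇒≡ _ _ w≡v)) w≢v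
    ...   | inj₂ eq  = agree⇒≡ _ _ eq

  Twins⇒areTwins : ∀ {u v} → Twins X u v → T (areTwins X u v)
  Twins⇒areTwins {u} {v} (mkTwins colors adjs) = Equivalence.from T-∧ (ℕ.≡⇒≡ᵇ _ _ colors ,
    All.all⁻ _ (All.tabulate {xs = allFin n} (λ {w} _ → same w)))
    where
    same : ∀ w → T ((toℕ w ≡ᵇ toℕ u) ∨ ((toℕ w ≡ᵇ toℕ v) ∨ agree (adj X u w) (adj X v w)))
    same w with w Fin.≟ u | w Fin.≟ v
    ... | yes w≡u | _       = Equivalence.from (T-∨ {toℕ w ≡ᵇ toℕ u}) (inj₁ (ℕ.≡⇒≡ᵇ _ _ (cong toℕ w≡u)))
    ... | no  _   | yes w≡v = Equivalence.from (T-∨ {toℕ w ≡ᵇ toℕ u}) (inj₂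
      (Equivalence.from (T-∨ {toℕ w ≡ᵇ toℕ v}) (inj₁ (ℕ.≡⇒≡ᵇ _ _ (cong toℕ w≡v)))))
    ... | no  w≢u | no  w≢v = Equivalence.from (T-∨ {toℕ w ≡ᵇ toℕ u}) (inj₂
      (Equivalence.from (T-∨ {toℕ w ≡ᵇ toℕ v}) (inj₂ (≡⇒agree _ _ (adjs w w≢u w≢v)))))

  twins-sym : ∀ {u v} → Twins X u v → Twins X v u
  twins-sym (mkTwins colors adjs) = mkTwins (sym colors) (λ w w≢v w≢u → sym (adjs w w≢u w≢v))

  twins-trans : ∀ {u v w} → u ≢ w → Twins X u v → Twins X v w → Twins X u w
  twins-trans {u} {v} {w} u≢w (mkTwins uv uv′) (mkTwins vw vw′) = mkTwins (trans uv vw) same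
    where
    same : ∀ x → x ≢ u → x ≢ w → adj X u x ≡ adj X w x
    same x x≢u x≢w with x Fin.≟ v
    ... | no  x≢v  = trans (uv′ x x≢u x≢v) (vw′ x x≢v x≢w)
    -- Here x is the middle vertex, about which neither hypothesis speaks directly. Its adjacencies
    -- to u and to w are compared by way of the pair u, w.
    ... | yes refl = begin
      adj X u x ≡⟨ symmetric X u x ⟩
      adj X x u ≡⟨ vw′ u (x≢u ∘ sym) u≢w ⟩
      adj X w u ≡⟨ symmetric X w u ⟩
      adj X u w ≡⟨ uv′ w (u≢w ∘ sym) (x≢w ∘ sym) ⟩
      adj X x w ≡⟨ symmetric X x w ⟩
      adj X w x ∎
      where open ≡-Reasoning

  later-twin : ∀ {u} → isKept X u ≡ false → ∃[ v ] toℕ u < toℕ v × Twins X u v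
  later-twin {u} ¬kept with find (Any.any⁻ _ (allFin n) (Equivalence.from T-≡ (Bool.not-injective ¬kept)))
  ... | v , _ , uv with Equivalence.to T-∧ uv
  ... | u<v , twins = v , ℕ.<ᵇ⇒< _ _ u<v , areTwins⇒Twins twins

  kept⇒no-later-twin : ∀ {u v} → isKept X u ≡ true → toℕ u < toℕ v → ¬ Twins X u v
  kept⇒no-later-twin {u} {v} kept u<v twins = contradiction
    (trans (sym kept) (cong not (Equivalence.to T-≡ (Any.any⁺ _ (lose (∈-allFin v)
      (Equivalence.from T-∧ (ℕ.<⇒<ᵇ u<v , Twins⇒areTwins twins))))))) (λ ())

  -- Passing from twin to later twin must end, and it can end only at a kept vertex, which by
  -- transitivity is a twin of `u`.
  kept-twin : ∀ u → isKept X u ≡ false → ∃[ v ] isKept X v ≡ true × u ≢ v × Twins X u v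
  kept-twin u ¬kept = let v , kept , u<v , twins = search u (>-wellFounded u) ¬kept in
    v , kept , (λ u≡v → ℕ.<-irrefl (cong toℕ u≡v) u<v) , twins
    where
    search : ∀ u → Acc _>_ u → isKept X u ≡ false → ∃[ v ] isKept X v ≡ true × toℕ u < toℕ v × Twins X u v
    search u (acc later) ¬kept with later-twin ¬kept
    ... | v , u<v , twins with isKept X v in eq
    ...   | true  = v , eq , u<v , twins
    ...   | false with search v (later u<v) eq
    ...     | w , kept , v<w , twins′ = w , kept , ℕ.<-trans u<v v<w ,
      twins-trans (λ u≡w → ℕ.<-irrefl (cong toℕ u≡w) (ℕ.<-trans u<v v<w)) twins twins′

module Swap {n} (X : ColoredGraph n) {a b : Fin n} (a≢b : a ≢ b) (twins : Twins X a b) where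

  open Twins twins

  τ : Fin n → Fin n
  τ x with x Fin.≟ a | x Fin.≟ b
  ... | yes _ | _     = b
  ... | no  _ | yes _ = a
  ... | no  _ | no  _ = x

  τ-a : τ a ≡ b
  τ-a with a Fin.≟ a
  ... | yes _   = refl
  ... | no  a≢a = contradiction refl a≢a

  τ-b : τ b ≡ a
  τ-b with b Fin.≟ a | b Fin.≟ b
  ... | yes b≡a | _       = contradiction (sym b≡a) a≢b
  ... | no  _   | yes _   = refl
  ... | no  _   | no  b≢b = contradiction refl b≢b

  τ-fix : ∀ {x} → x ≢ a → x ≢ b → τ x ≡ x
  τ-fix {x} x≢a x≢b with x Fin.≟ a | x Fin.≟ b
  ... | yes x≡a | _       = contradiction x≡a x≢a
  ... | no  _   | yes x≡b = contradiction x≡b x≢b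
  ... | no  _   | no  _   = refl

  data View : Fin n → Set where
    is-a  : View a
    is-b  : View b
    other : ∀ {x} → x ≢ a → x ≢ b → View x

  view : ∀ x → View x
  view x with x Fin.≟ a | x Fin.≟ b
  ... | yes refl | _        = is-a
  ... | no  _    | yes refl = is-b
  ... | no  x≢a  | no  x≢b  = other x≢a x≢b

  τ-involutive : ∀ x → τ (τ x) ≡ x
  τ-involutive x with view x
  ... | is-a = trans (cong τ τ-a) τ-b
  ... | is-b = trans (cong τ τ-b) τ-a
  ... | other x≢a x≢b = trans (cong τ (τ-fix x≢a x≢b)) (τ-fix x≢a x≢b)

  τ-injective : ∀ {x y} → τ x ≡ τ y → x ≡ y
  τ-injective {x} {y} eq = trans (sym (τ-involutive x)) (trans (cong τ eq) (τ-involutive y))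

  τ-color : ∀ x → color X (τ x) ≡ color X x
  τ-color x with view x
  ... | is-a          = trans (cong (color X) τ-a) (sym sameColor)
  ... | is-b          = trans (cong (color X) τ-b) sameColor
  ... | other x≢a x≢b = cong (color X) (τ-fix x≢a x≢b)

  τ-adj : ∀ x y → adj X (τ x) (τ y) ≡ adj X x y
  τ-adj x y with view x | view y
  ... | is-a | is-a = trans (loopless X (τ a)) (sym (loopless X a))
  ... | is-b | is-b = trans (loopless X (τ b)) (sym (loopless X b))
  ... | is-a | is-b = trans (cong₂ (adj X) τ-a τ-b) (symmetric X b a)
  ... | is-b | is-a = trans (cong₂ (adj X) τ-b τ-a) (symmetric X a b)
  ... | is-a | other y≢a y≢b = trans (cong₂ (adj X) τ-a (τ-fix y≢a y≢b)) (sym (sameAdj _ y≢a y≢b))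
  ... | is-b | other y≢a y≢b = trans (cong₂ (adj X) τ-b (τ-fix y≢a y≢b)) (sameAdj _ y≢a y≢b)
  ... | other x≢a x≢b | is-a = trans (symmetric X _ _) (trans (cong₂ (adj X) τ-a (τ-fix x≢a x≢b))
                                 (trans (sym (sameAdj _ x≢a x≢b)) (symmetric X _ _)))
  ... | other x≢a x≢b | is-b = trans (symmetric X _ _) (trans (cong₂ (adj X) τ-b (τ-fix x≢a x≢b))
                                 (trans (sameAdj _ x≢a x≢b) (symmetric X _ _)))
  ... | other x≢a x≢b | other y≢a y≢b = cong₂ (adj X) (τ-fix x≢a x≢b) (τ-fix y≢a y≢b)

  neighbors-τ : ∀ u → neighbors X u ↭ map τ (neighbors X (τ u))
  neighbors-τ u = ∼bag⇒↭ (unique∧set⇒bag (Unique-neighbors X u) (Unique.map⁺ τ-injective (Unique-neighbors X (τ u))) (mk⇔ to from))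
    where
    to : ∀ {x} → x ∈ neighbors X u → x ∈ map τ (neighbors X (τ u))
    to {x} x∈ = subst (_∈ map τ (neighbors X (τ u))) (τ-involutive x)
      (∈-map⁺ τ (∈-neighbors⁺ X (trans (τ-adj u x) (∈-neighbors⁻ X x∈))))

    from : ∀ {x} → x ∈ map τ (neighbors X (τ u)) → x ∈ neighbors X u
    from x∈ with ∈-map⁻ τ x∈
    ... | y , y∈ , refl = ∈-neighbors⁺ X (trans (sym (τ-adj u (τ y)))
      (trans (cong (adj X (τ u)) (τ-involutive y)) (∈-neighbors⁻ X y∈)))

  -- The orbits of the automorphism τ are not split by color refinement.
  determined⇒≡ : ∀ {W} → Determined X W → a ∈ W → b ∈ W → a ≡ b
  determined⇒≡ {W} determined a∈W b∈W = determined E equitable single (inj₂ (sym τ-a))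
    where
    E : Rel (Fin n) 0ℓ
    E x y = y ≡ x ⊎ y ≡ τ x

    equivalence : IsEquivalence E
    equivalence = record
      { refl  = inj₁ refl
      ; sym   = λ { (inj₁ refl) → inj₁ refl ; (inj₂ refl) → inj₂ (sym (τ-involutive _)) }
      ; trans = λ { (inj₁ refl) yz → yz
                  ; (inj₂ refl) (inj₁ refl) → inj₂ refl
                  ; (inj₂ refl) (inj₂ refl) → inj₁ (τ-involutive _) }
      }

    balanced : ∀ u → Permutation E (neighbors X u) (neighbors X (τ u))
    balanced u = Homogeneous.trans
      (Homogeneous.refl (moves (neighbors X u)))
      (Homogeneous.map (λ { refl → inj₁ refl }) (↭⇒↭ₛ (↭-sym (neighbors-τ′ u))))
      where
      moves : ∀ xs → Pointwise E xs (map τ xs)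
      moves []       = []
      moves (x ∷ xs) = inj₂ refl ∷ moves xs

      neighbors-τ′ : ∀ u → neighbors X (τ u) ↭ map τ (neighbors X u)
      neighbors-τ′ u = subst (λ v → neighbors X (τ u) ↭ map τ (neighbors X v)) (τ-involutive u) (neighbors-τ (τ u))

    equitable : Equitable X E
    equitable = record
      { isEquivalence = equivalence
      ; sameColor     = λ { (inj₁ refl) → refl ; {u} (inj₂ refl) → sym (τ-color u) }
      ; balanced      = λ { (inj₁ refl) → Homogeneous.refl (Pointwise.refl (inj₁ refl)) ; {u} (inj₂ refl) → balanced u }
      }

    single : SingledOut (_∉ W) E
    single x∉W (inj₁ refl) = refl
    single x∉W (inj₂ refl) = sym (τ-fix (λ { refl → x∉W a∈W }) (λ { refl → x∉W b∈W }))

  -- The automorphism `τ` carries `a ∷ W` onto `b ∷ W`. Pulling back along it turns an equitable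
  -- relation that singles out everything outside of `b ∷ W` into one that does so for `a ∷ W`.
  determined-swap : ∀ {W} → a ∉ W → b ∉ W → Determined X (a ∷ W) → Determined X (b ∷ W)
  determined-swap {W} a∉W b∉W determined E equitable single {u} {v} uv = τ-injective
    (determined E′ equitable′ single′ (subst₂ E (sym (τ-involutive u)) (sym (τ-involutive v)) uv))
    where
    open Equitable equitable using (module Eq; balanced)

    E′ : Rel (Fin n) 0ℓ
    E′ x y = E (τ x) (τ y)

    E⇒E′ : ∀ {x y} → E x y → E′ (τ x) (τ y)
    E⇒E′ {x} {y} = subst₂ E (sym (τ-involutive x)) (sym (τ-involutive y))

    equivalence′ : IsEquivalence E′
    equivalence′ = record { refl = Eq.refl ; sym = Eq.sym ; trans = Eq.trans }

    relate : ∀ {xs ys} → xs ↭ ys → Permutation E′ xs ys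
    relate xs↭ys = Homogeneous.map (λ { refl → Eq.refl }) (↭⇒↭ₛ xs↭ys)

    equitable′ : Equitable X E′
    equitable′ = record
      { isEquivalence = equivalence′
      ; sameColor     = λ {x} {y} xy → trans (sym (τ-color x)) (trans (Equitable.sameColor equitable xy) (τ-color y))
      ; balanced      = λ {x} {y} xy → Homogeneous.trans (relate (neighbors-τ x)) (Homogeneous.trans
          (Permutationₛ.map⁺ (Equitable.setoid equitable) (record { isEquivalence = equivalence′ }) E⇒E′ (balanced xy))
          (relate (↭-sym (neighbors-τ y))))
      }

    moved : ∀ {x} → x ∉ a ∷ W → τ x ∉ b ∷ W
    moved {x} x∉ τx∈ with view x
    ... | is-a = x∉ (here refl)
    ... | is-b with subst (_∈ b ∷ W) τ-b τx∈
    ...   | here a≡b  = a≢b a≡b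
    ...   | there a∈W = a∉W a∈W
    moved {x} x∉ τx∈ | other x≢a x≢b with subst (_∈ b ∷ W) (τ-fix x≢a x≢b) τx∈
    ... | here x≡b  = x≢b x≡b
    ... | there x∈W = x∉ (there x∈W)

    single′ : SingledOut (_∉ a ∷ W) E′
    single′ x∉ xy = τ-injective (single (moved x∉) xy)

-- Exchanging spared vertices for kept ones

module _ {n} (X : ColoredGraph n) where

  AllKept : List (Fin n) → Set
  AllKept = All (λ v → isKept X v ≡ true)

  -- `V` is still to be treated, `U` consists of kept vertices already. A vertex of `V` that is not
  -- kept gives place to a kept twin. The twin is not yet on the list, since two twins are never
  -- both spared, so the length of the list is preserved.
  exchange : ∀ V {U} → AllKept U → Unique (V ++ U) → Determined X (V ++ U) →
             ∃[ W ] AllKept W × Unique W × length W ≡ length V + length U × Determined X W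
  exchange-head : ∀ V {U b} → isKept X b ≡ true → b ∉ V ++ U →
                  AllKept U → Unique (V ++ U) → Determined X (b ∷ V ++ U) →
                  ∃[ W ] AllKept W × Unique W × length W ≡ suc (length V + length U) × Determined X W

  exchange []      keptU unique determined = _ , keptU , unique , refl , determined
  exchange (a ∷ V) keptU (a∉ ∷ unique) determined with isKept X a in kept-a
  ... | true  = exchange-head V kept-a (λ a∈ → All.lookup a∉ a∈ refl) keptU unique determined
  ... | false =
    let b , kept-b , a≢b , twins = kept-twin X a kept-a
        open Swap X a≢b twins
        b∉ = λ b∈ → a≢b (determined⇒≡ determined (here refl) (there b∈))
    in exchange-head V kept-b b∉ keptU unique (determined-swap (λ a∈ → All.lookup a∉ a∈ refl) b∉ determined)

  exchange-head V {U} {b} kept-b b∉ keptU unique determined =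
    let shifted = ↭.shift b V U
        W , keptW , uniqueW , length≡ , determinedW = exchange V (kept-b ∷ keptU)
          (Permutationₛ.Unique-resp-↭ (≡.setoid _) (↭⇒↭ₛ (↭-sym shifted))
            (All.tabulate (λ x∈ b≡x → b∉ (subst (_∈ V ++ U) (sym b≡x) x∈)) ∷ unique))
          (Determined-⊆ {X = X} (↭.∈-resp-↭ shifted) determined)
    in W , keptW , uniqueW , trans length≡ (ℕ.+-suc (length V) (length U)) , determinedW

-- Deleting all but one vertex of each twin class

module _ {A : Set} where

  filterᵇ-comm : ∀ (p q : A → Bool) xs → filterᵇ p (filterᵇ q xs) ≡ filterᵇ q (filterᵇ p xs)
  filterᵇ-comm p q []       = refl
  filterᵇ-comm p q (x ∷ xs) with p x in px | q x in qx
  ... | true  | true  rewrite px | qx = cong (x ∷_) (filterᵇ-comm p q xs)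
  ... | true  | false rewrite qx = filterᵇ-comm p q xs
  ... | false | true  rewrite px = filterᵇ-comm p q xs
  ... | false | false = filterᵇ-comm p q xs

  filterᵇ-map : ∀ {B : Set} (p : B → Bool) (f : A → B) xs → filterᵇ p (map f xs) ≡ map f (filterᵇ (p ∘ f) xs)
  filterᵇ-map p f []       = refl
  filterᵇ-map p f (x ∷ xs) with p (f x)
  ... | true  = cong (f x ∷_) (filterᵇ-map p f xs)
  ... | false = filterᵇ-map p f xs

  filterᵇ-filterᵇ-cong : ∀ (p q r : A → Bool) xs → (∀ x → p x ≡ true → q x ≡ r x) →
                         filterᵇ p (filterᵇ q xs) ≡ filterᵇ p (filterᵇ r xs)
  filterᵇ-filterᵇ-cong p q r []       eq = refl
  filterᵇ-filterᵇ-cong p q r (x ∷ xs) eq with p x in px | q x in qx | r x in rx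
  ... | true  | true  | true  rewrite px = cong (x ∷_) (filterᵇ-filterᵇ-cong p q r xs eq)
  ... | true  | true  | false = contradiction (trans (sym qx) (trans (eq x px) rx)) (λ ())
  ... | true  | false | true  = contradiction (trans (sym qx) (trans (eq x px) rx)) (λ ())
  ... | _     | false | false = filterᵇ-filterᵇ-cong p q r xs eq
  ... | false | true  | true  rewrite px = filterᵇ-filterᵇ-cong p q r xs eq
  ... | false | true  | false rewrite px = filterᵇ-filterᵇ-cong p q r xs eq
  ... | false | false | true  rewrite px = filterᵇ-filterᵇ-cong p q r xs eq

  filterᵇ-split : ∀ (p : A → Bool) xs → xs ↭ filterᵇ p xs ++ filterᵇ (not ∘ p) xs
  filterᵇ-split p []       = ↭-refl
  filterᵇ-split p (x ∷ xs) with p x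
  ... | true  = ↭-prep x (filterᵇ-split p xs)
  ... | false = ↭-trans (↭-prep x (filterᵇ-split p xs)) (↭-sym (↭.shift x (filterᵇ p xs) _))

  lookup-injective : ∀ {xs : List A} → Unique xs → ∀ i j → lookup xs i ≡ lookup xs j → i ≡ j
  lookup-injective (x∉ ∷ unique) zero    zero    eq = refl
  lookup-injective (x∉ ∷ unique) zero    (suc j) eq = contradiction eq (All.lookup x∉ (∈-lookup j))
  lookup-injective (x∉ ∷ unique) (suc i) zero    eq = contradiction (sym eq) (All.lookup x∉ (∈-lookup i))
  lookup-injective (x∉ ∷ unique) (suc i) (suc j) eq = cong suc (lookup-injective unique i j eq)

prependBit-injective : ∀ b b′ {c c′} → prependBit b c ≡ prependBit b′ c′ → b ≡ b′ × c ≡ c′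
prependBit-injective true  true  eq = refl , ℕ.*-cancelˡ-≡ _ _ 2 (ℕ.suc-injective eq)
prependBit-injective false false eq = refl , ℕ.suc-injective (ℕ.*-cancelˡ-≡ _ _ 2 eq)
prependBit-injective true  false {c} {c′} eq = contradiction (sym eq) (ℕ.even≢odd (suc c′) c)
prependBit-injective false true  {c} {c′} eq = contradiction eq (ℕ.even≢odd (suc c) c′)

module _ {n} (X : ColoredGraph n) where

  -- Both colors are built from one digit for each deleted vertex, in the same order. The digits can
  -- thus be peeled off pair by pair until the original colors are left.
  newColor-injective : ∀ {v w} → newColor X v ≡ newColor X w →
                       color X v ≡ color X w × (∀ u → isKept X u ≡ false → adj X u v ≡ adj X u w)
  newColor-injective {v} {w} eq = let eq′ , adjs = go (allFin n) eq in eq′ , λ u → adjs (∈-allFin u)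
    where
    go : ∀ us → (let new = λ v → foldr (λ u c → if isKept X u then c else prependBit (adj X u v) c) (color X v) us) →
         new v ≡ new w → color X v ≡ color X w × (∀ {u} → u ∈ us → isKept X u ≡ false → adj X u v ≡ adj X u w)
    go []       eq = eq , λ ()
    go (u ∷ us) eq with isKept X u in kept
    ... | true  = let eq′ , adjs = go us eq in
      eq′ , λ { (here refl) ¬kept → contradiction (trans (sym kept) ¬kept) (λ ()) ; (there u∈) → adjs u∈ }
    ... | false = let adj≡ , rest  = prependBit-injective (adj X u v) (adj X u w) eq
                      eq′ , adjs = go us rest
                  in eq′ , λ { (here refl) _ → adj≡ ; (there u∈) → adjs u∈ }

  module _ {E : Rel (Fin n) 0ℓ} (equitable : Equitable X E) where

    open Equitable equitable using (module Eq; balanced)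

    related-neighbor : ∀ {u v w} → E v w → adj X v u ≡ true → ∃[ u′ ] adj X w u′ ≡ true × E u u′
    related-neighbor {u} vw vu with find (Permutationₛ.Any-resp-↭ (Equitable.setoid equitable) (λ xy ux → Eq.trans ux xy)
                                           (balanced vw) (lose (∈-neighbors⁺ X vu) (Eq.refl {u})))
    ... | u′ , u′∈ , uu′ = u′ , ∈-neighbors⁻ X u′∈ , uu′

    -- A neighbor of w that is matched with the neighbor `u` of v lies in the class of `u`, hence is
    -- `u`. This is why the adjacencies of an individualized vertex can be stored in colors.
    singleton-adj : ∀ {u v w} → (∀ {y} → E u y → u ≡ y) → E v w → adj X v u ≡ adj X w u
    singleton-adj {u} single vw = Bool.⇔→≡ {z = true} (mk⇔ (half vw) (half (Eq.sym vw)))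
      where
      half : ∀ {v w} → E v w → adj X v u ≡ true → adj X w u ≡ true
      half vw vu with related-neighbor vw vu
      ... | u′ , wu′ , uu′ with single uu′
      ... | refl = wu′

  private
    m = length (kept X)
    K = twinFree X

    ι : Fin m → Fin n
    ι = lookup (kept X)

  ι-injective : ∀ {i j} → ι i ≡ ι j → i ≡ j
  ι-injective = lookup-injective (Unique-filterᵇ (isKept X) (Unique.allFin⁺ n)) _ _

  ι-kept : ∀ i → isKept X (ι i) ≡ true
  ι-kept i = proj₂ (∈-filterᵇ⁻ (isKept X) {allFin n} (∈-lookup i))

  ι-surjective : ∀ {x} → isKept X x ≡ true → ∃[ i ] ι i ≡ x
  ι-surjective {x} kept-x = let x∈ = ∈-filterᵇ⁺ (isKept X) (∈-allFin x) kept-x in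
    Any.index x∈ , sym (Any.lookup-index x∈)

  ∉-map-ι : ∀ {x W} → isKept X x ≡ false → x ∉ map ι W
  ∉-map-ι ¬kept x∈ with ∈-map⁻ ι x∈
  ... | i , _ , refl = contradiction (trans (sym (ι-kept i)) ¬kept) (λ ())

  neighbors-ι : ∀ i → filterᵇ (isKept X) (neighbors X (ι i)) ≡ map ι (neighbors K i)
  neighbors-ι i = begin
    filterᵇ (isKept X) (filterᵇ (adj X (ι i)) (allFin n)) ≡⟨ filterᵇ-comm (isKept X) (adj X (ι i)) (allFin n) ⟩
    filterᵇ (adj X (ι i)) (kept X)                        ≡⟨ cong (filterᵇ (adj X (ι i))) kept≡ ⟩
    filterᵇ (adj X (ι i)) (map ι (allFin m))              ≡⟨ filterᵇ-map (adj X (ι i)) ι (allFin m) ⟩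
    map ι (filterᵇ (adj X (ι i) ∘ ι) (allFin m))          ∎
    where
    open ≡-Reasoning
    kept≡ : kept X ≡ map ι (allFin m)
    kept≡ = trans (sym (List.tabulate-lookup (kept X))) (sym (List.map-tabulate id ι))

  -- Deleted vertices are singletons of `E`, so no class mixes them with kept ones and `E` restricts
  -- to the kernel. Each of them is adjacent to all or none of a class, so related vertices receive
  -- the same digits in their new colors.
  determined-twinFree⁺ : ∀ {W} → Determined K W → Determined X (map ι W)
  determined-twinFree⁺ {W} determined E equitable single {u} {v} uv
    with isKept X u in kept-u | isKept X v in kept-v
  ... | false | _     = single (∉-map-ι kept-u) uv
  ... | true  | false = sym (single (∉-map-ι kept-v) (Equitable.Eq.sym equitable uv))
  ... | true  | true with ι-surjective kept-u | ι-surjective kept-v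
  ...   | i , refl | j , refl = cong ι (determined E′ equitable′ single′ uv)
    where
    open Equitable equitable using (module Eq)

    E′ : Rel (Fin m) 0ℓ
    E′ i j = E (ι i) (ι j)

    equivalence′ : IsEquivalence E′
    equivalence′ = record { refl = Eq.refl ; sym = Eq.sym ; trans = Eq.trans }

    -- A left inverse of ι on the kept vertices; its other values do not
    -- matter because deleted vertices are singletons for E.
    index : Fin m → Fin n → Fin m
    index default x with isKept X x Bool.≟ true
    ... | yes kept-x = proj₁ (ι-surjective kept-x)
    ... | no  _      = default

    index-ι : ∀ d i → index d (ι i) ≡ i
    index-ι d i with isKept X (ι i) Bool.≟ true
    ... | yes kept-i = ι-injective (proj₂ (ι-surjective kept-i))
    ... | no  ¬kept  = contradiction (ι-kept i) ¬kept

    index-E : ∀ d {x y} → E x y → E′ (index d x) (index d y)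
    index-E d {x} {y} xy with isKept X x Bool.≟ true | isKept X y Bool.≟ true
    ... | yes kept-x | yes kept-y = subst₂ E (sym (proj₂ (ι-surjective kept-x))) (sym (proj₂ (ι-surjective kept-y))) xy
    ... | no  _      | no  _      = Eq.refl
    ... | no  ¬kept  | yes kept-y =
      contradiction (trans (cong (isKept X) (single (∉-map-ι (Bool.¬-not ¬kept)) xy)) kept-y) ¬kept
    ... | yes kept-x | no  ¬kept  =
      contradiction (trans (cong (isKept X) (single (∉-map-ι (Bool.¬-not ¬kept)) (Eq.sym xy))) kept-x) ¬kept

    map-index : ∀ d is → map (index d) (map ι is) ≡ is
    map-index d is = trans (sym (List.map-∘ is)) (trans (List.map-cong (index-ι d) is) (List.map-id is))

    isKept-resp : ∀ {x y} → E x y → T (isKept X x) → T (isKept X y)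
    isKept-resp {x} {y} xy kept-x with isKept X y Bool.≟ true
    ... | yes kept-y = Equivalence.from Bool.T-≡ kept-y
    ... | no  ¬kept  = subst (T ∘ isKept X) (sym (single (∉-map-ι (Bool.¬-not ¬kept)) (Eq.sym xy))) kept-x

    balanced′ : ∀ {i j} → E′ i j → Permutation E′ (neighbors K i) (neighbors K j)
    balanced′ {i} {j} ij = subst₂ (Permutation E′)
      (trans (cong (map (index i)) (neighbors-ι i)) (map-index i (neighbors K i)))
      (trans (cong (map (index i)) (neighbors-ι j)) (map-index i (neighbors K j)))
      -- The matching in `X` is first restricted to the kept vertices, which is possible as classes
      -- are not mixed, and then carried to the kernel by `index`. The default `i` is available
      -- since i is a vertex of the kernel.
      (Permutationₛ.map⁺ (Equitable.setoid equitable) (record { isEquivalence = equivalence′ }) (index-E i)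
        (Permutationₛ.filter⁺ (Equitable.setoid equitable) (Bool.T? ∘ isKept X) isKept-resp (Equitable.balanced equitable ij)))

    newColor≡ : ∀ {i j} → E′ i j → newColor X (ι i) ≡ newColor X (ι j)
    newColor≡ {i} {j} ij = go (allFin n)
      where
      go : ∀ us → foldr (λ u c → if isKept X u then c else prependBit (adj X u (ι i)) c) (color X (ι i)) us ≡
                  foldr (λ u c → if isKept X u then c else prependBit (adj X u (ι j)) c) (color X (ι j)) us
      go []       = Equitable.sameColor equitable ij
      go (u ∷ us) with isKept X u in kept-u
      ... | true  = go us
      ... | false = cong₂ prependBit (trans (symmetric X u (ι i))
        (trans (singleton-adj equitable (single (∉-map-ι kept-u)) ij) (symmetric X (ι j) u))) (go us)

    equitable′ : Equitable K E′
    equitable′ = record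
      { isEquivalence = equivalence′
      ; sameColor     = newColor≡
      ; balanced      = balanced′
      }

    single′ : SingledOut (_∉ W) E′
    single′ {i} i∉W ij = ι-injective (single (λ ιi∈ → i∉W (let j , j∈W , eq = ∈-map⁻ ι ιi∈
                                                       in subst (_∈ W) (sym (ι-injective eq)) j∈W)) ij)

  -- The relation is extended to `X` by singletons. Kept neighbors of related vertices are matched
  -- as in the kernel, and their deleted neighbors are even the same, because the new colors record
  -- them.
  determined-twinFree⁻ : ∀ {W} → Determined X (map ι W) → Determined K W
  determined-twinFree⁻ {W} determined E′ equitable′ single′ {i} {j} ij =
    ι-injective (determined E equitable single (lift ij))
    where
    open Equitable equitable′ using (module Eq)

    data E : Rel (Fin n) 0ℓ where
      equal : ∀ {x} → E x x
      lift  : ∀ {i j} → E′ i j → E (ι i) (ι j)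

    E-sym : ∀ {x y} → E x y → E y x
    E-sym equal     = equal
    E-sym (lift ij) = lift (Eq.sym ij)

    -- Values of `ι` cannot be matched on, so the left end is only equated with `ι i` and
    -- injectivity recovers the index.
    E-trans′ : ∀ {i x y} → E x y → x ≡ ι i → ∃[ j ] y ≡ ι j × E′ i j
    E-trans′ equal                eq = _ , eq , Eq.refl
    E-trans′ {i} (lift {i′} {j} ij) eq = j , refl , subst (λ i → E′ i j) (ι-injective eq) ij

    E-trans : ∀ {x y z} → E x y → E y z → E x z
    E-trans equal     yz = yz
    E-trans (lift ij) yz with E-trans′ yz refl
    ... | k , refl , jk = lift (Eq.trans ij jk)

    equivalence : IsEquivalence E
    equivalence = record { refl = equal ; sym = E-sym ; trans = E-trans }

    colors : ∀ {i j} → E′ i j → _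
    colors {i} {j} ij = newColor-injective {ι i} {ι j} (Equitable.sameColor equitable′ ij)

    reflexively : ∀ {xs ys} → xs ↭ ys → Permutation E xs ys
    reflexively xs↭ys = Homogeneous.map (λ { refl → equal }) (↭⇒↭ₛ xs↭ys)

    balanced : ∀ {x y} → E x y → Permutation E (neighbors X x) (neighbors X y)
    balanced equal              = Homogeneous.refl (Pointwise.refl equal)
    balanced (lift {i} {j} ij) = Homogeneous.trans (reflexively (filterᵇ-split (isKept X) (neighbors X (ι i))))
      (Homogeneous.trans
        (Permutationₛ.++⁺ (record { isEquivalence = equivalence })
          (subst₂ (Permutation E) (sym (neighbors-ι i)) (sym (neighbors-ι j))
            (Permutationₛ.map⁺ (Equitable.setoid equitable′) (record { isEquivalence = equivalence }) lift
              (Equitable.balanced equitable′ ij)))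
          (Homogeneous.refl (Pointwise.map (λ { refl → equal }) (Pointwise.≡⇒Pointwise-≡ deleted))))
        (Homogeneous.sym E-sym (reflexively (filterᵇ-split (isKept X) (neighbors X (ι j))))))
      where
      deleted : filterᵇ (not ∘ isKept X) (neighbors X (ι i)) ≡ filterᵇ (not ∘ isKept X) (neighbors X (ι j))
      deleted = filterᵇ-filterᵇ-cong (not ∘ isKept X) (adj X (ι i)) (adj X (ι j)) (allFin n)
        (λ u ¬kept → trans (symmetric X (ι i) u)
          (trans (proj₂ (colors ij) u (Bool.not-injective ¬kept)) (symmetric X u (ι j))))

    equitable : Equitable X E
    equitable = record
      { isEquivalence = equivalence
      ; sameColor     = λ { equal → refl ; (lift ij) → proj₁ (colors ij) }
      ; balanced      = balanced
      }

    single : SingledOut (_∉ map ι W) E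
    single x∉ equal     = refl
    single x∉ (lift ij) = cong ι (single′ (x∉ ∘ ∈-map⁺ ι) ij)

-- Twin-free graphs

∣p∪q∣≤∣p∣+∣q∣ : ∀ {n} (p q : Subset n) → ∣ p ∪ q ∣ ≤ ∣ p ∣ + ∣ q ∣
∣p∪q∣≤∣p∣+∣q∣ []            []            = z≤n
∣p∪q∣≤∣p∣+∣q∣ (true ∷ p)  (true ∷ q)  = s≤s (ℕ.≤-trans (∣p∪q∣≤∣p∣+∣q∣ p q) (ℕ.+-monoʳ-≤ ∣ p ∣ (ℕ.n≤1+n _)))
∣p∪q∣≤∣p∣+∣q∣ (true ∷ p)  (false ∷ q) = s≤s (∣p∪q∣≤∣p∣+∣q∣ p q)
∣p∪q∣≤∣p∣+∣q∣ (false ∷ p) (true ∷ q)  = ℕ.≤-trans (s≤s (∣p∪q∣≤∣p∣+∣q∣ p q)) (ℕ.≤-reflexive (sym (ℕ.+-suc ∣ p ∣ ∣ q ∣)))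
∣p∪q∣≤∣p∣+∣q∣ (false ∷ p) (false ∷ q) = ∣p∪q∣≤∣p∣+∣q∣ p q

module _ {n} {X : ColoredGraph n} {E E′ : Rel (Fin n) 0ℓ} (E? : Decidable E)
         (equitable : Equitable X E) (equitable′ : Equitable X E′) where

  private
    module E = Equitable equitable

  -- If isolating v refines E no further, then v is adjacent to all or to none
  -- of each E-class, apart from v itself.  By balance the same classes are
  -- joined to z.
  isolated⇒twins : ∀ {v z} → (∀ {y} → E′ v y → v ≡ y) → (∀ {x y} → x ≢ v → y ≢ v → E x y → E′ x y) →
                   v ≢ z → E v z → Twins X v z
  isolated⇒twins {v} {z} single rest v≢z vz = mkTwins (E.sameColor vz) same
    where
    alike : ∀ {x y} → x ≢ v → y ≢ v → E x y → adj X v x ≡ adj X v y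
    alike {x} {y} x≢v y≢v xy = trans (symmetric X v x)
      (trans (singleton-adj X equitable′ single (rest x≢v y≢v xy)) (symmetric X y v))

    neighbor≢ : ∀ {x} → adj X v x ≡ true → x ≢ v
    neighbor≢ vx refl = contradiction (trans (sym vx) (loopless X v)) (λ ())

    to : ∀ {w} → w ≢ v → adj X z w ≡ true → adj X v w ≡ true
    to w≢v zw with related-neighbor X equitable (E.Eq.sym vz) zw
    ... | w′ , vw′ , ww′ = trans (alike w≢v (neighbor≢ vw′) ww′) vw′

    from : ∀ {w} → w ≢ v → w ≢ z → adj X v w ≡ true → adj X z w ≡ true
    from {w} w≢v w≢z vw with adj X z w Bool.≟ true
    ... | yes zw = zw
    ... | no ¬zw = contradiction
      (ℕ.≤-trans (Unique-⊆⇒length≤ (w∉ ∷ unique) included) (ℕ.≤-reflexive (Permutationₛ.xs↭ys⇒|xs|≡|ys| E.setoid closed)))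
      (ℕ.<-irrefl refl)
      where
      -- A count within the class of w: if z were not adjacent to w, its closed neighborhood there
      -- would be contained in that of v and miss w, although balance makes both equally large. They
      -- are closed because v itself may belong to this class.
      near : Fin n → List (Fin n)
      near x = filter (E? w) (x ∷ neighbors X x)

      closed : Permutation E (near v) (near z)
      closed = Permutationₛ.filter⁺ E.setoid (E? w) (λ xy wx → E.Eq.trans wx xy) (prep vz (E.balanced vz))

      w∉ : All (w ≢_) (near z)
      w∉ = All.tabulate λ x∈ w≡x → case (proj₁ (∈-filter⁻ (E? w) {xs = z ∷ neighbors X z} x∈)) w≡x
        where
        case : ∀ {x} → x ∈ z ∷ neighbors X z → w ≢ x
        case (here refl) w≡z  = w≢z w≡z
        case (there x∈)  refl = ¬zw (∈-neighbors⁻ X x∈)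

      unique : Unique (near z)
      unique = Unique.filter⁺ (E? w) (All.tabulate (λ {x} x∈ z≡x →
        contradiction (trans (sym (∈-neighbors⁻ X x∈)) (trans (cong (adj X z) (sym z≡x)) (loopless X z))) (λ ()))
        ∷ Unique-neighbors X z)

      class : ∀ {x} → x ∈ w ∷ near z → E w x
      class (here refl) = E.Eq.refl
      class (there x∈)  = proj₂ (∈-filter⁻ (E? w) {xs = z ∷ neighbors X z} x∈)

      included : w ∷ near z ⊆ near v
      included {x} x∈ with x Fin.≟ v
      ... | yes refl = ∈-filter⁺ (E? w) (here refl) (class x∈)
      ... | no  x≢v  = ∈-filter⁺ (E? w) (there (∈-neighbors⁺ X (trans (sym (alike w≢v x≢v (class x∈))) vw))) (class x∈)

    same : ∀ w → w ≢ v → w ≢ z → adj X v w ≡ adj X z w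
    same w w≢v w≢z = Bool.⇔→≡ {z = true} (mk⇔ (from w≢v w≢z) (to w≢v))

module _ {n} (X : ColoredGraph n) (S : Subset n) where

  private
    individualized = individualization (color X) S
    coarse = coarsestEquitable (recolor X (proj₁ individualized))

  open Coarsest coarse public using () renaming (E to Class; E? to class?)

  -- With the two properties that follow, this describes the partition computed after
  -- individualizing `S` without reference to the chosen colors.
  class-equitable : Equitable X Class
  class-equitable = proj₁ (recolor-equitable⁻ (proj₂ individualized) (Coarsest.equitable coarse))

  class-single : SingledOut (Subset._∈ S) Class
  class-single = proj₂ (recolor-equitable⁻ (proj₂ individualized) (Coarsest.equitable coarse))

  class-coarsest : ∀ {E} → Equitable X E → SingledOut (Subset._∈ S) E → ∀ {u v} → E u v → Class u v
  class-coarsest equitable single = Coarsest.coarsest coarse (recolor-equitable⁺ (proj₂ individualized) equitable single)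

module _ {n} (X : ColoredGraph n) (noTwins : ∀ {u v} → u ≢ v → ¬ Twins X u v) where

  -- Individualizing a vertex v of a nontrivial class adds at least two
  -- classes: one by isolating v, one because otherwise v would have a twin.
  two-more-classes : ∀ {S T v z} → Separated (Class X S) T → v ≢ z → Class X S v z →
                     ∃[ x ] ∃[ y ] Separated (Class X (S ∪ ⁅ v ⁆)) (x ∷ y ∷ T)
  two-more-classes {S} {T} {v} {z} separated v≢z vz = conclude
    where
    S′ = S ∪ ⁅ v ⁆
    module E  = Equitable (class-equitable X S)
    module E′ = Equitable (class-equitable X S′)

    single-v : ∀ {y} → Class X S′ v y → v ≡ y
    single-v = class-single X S′ (Subset.q⊆p∪q S ⁅ v ⁆ (Subset.x∈⁅x⁆ v))

    Class′⇒Class : ∀ {x y} → Class X S′ x y → Class X S x y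
    Class′⇒Class = class-coarsest X S (class-equitable X S′)
      (λ x∈S → class-single X S′ (Subset.p⊆p∪q ⁅ v ⁆ x∈S))

    -- This relation splits v off and changes nothing else, so it lies between the partitions for
    -- `S` and for `S′`. Each of the two refinements is proper and contributes one representative.
    Isolated : Rel (Fin n) 0ℓ
    Isolated x y = x ≡ y ⊎ (x ≢ v × y ≢ v × Class X S x y)

    isolated-equivalence : IsEquivalence Isolated
    isolated-equivalence = record
      { refl  = inj₁ refl
      ; sym   = λ { (inj₁ refl) → inj₁ refl ; (inj₂ (x≢v , y≢v , xy)) → inj₂ (y≢v , x≢v , E.Eq.sym xy) }
      ; trans = λ { (inj₁ refl) yz → yz
                  ; (inj₂ xy) (inj₁ refl) → inj₂ xy
                  ; (inj₂ (x≢v , _ , xy)) (inj₂ (_ , z≢v , yz)) → inj₂ (x≢v , z≢v , E.Eq.trans xy yz) }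
      }

    isolated? : Decidable Isolated
    isolated? x y = (x Fin.≟ y) ⊎-dec (¬? (x Fin.≟ v) ×-dec (¬? (y Fin.≟ v) ×-dec class? X S x y))

    Isolated⇒Class : ∀ {x y} → Isolated x y → Class X S x y
    Isolated⇒Class (inj₁ refl)         = E.Eq.refl
    Isolated⇒Class (inj₂ (_ , _ , xy)) = xy

    Class′⇒Isolated : ∀ {x y} → Class X S′ x y → Isolated x y
    Class′⇒Isolated {x} {y} xy with x Fin.≟ v | y Fin.≟ v
    ... | yes refl | _        = inj₁ (single-v xy)
    ... | no  _    | yes refl = inj₁ (sym (single-v (E′.Eq.sym xy)))
    ... | no  x≢v  | no  y≢v  = inj₂ (x≢v , y≢v , Class′⇒Class xy)

    ¬isolated : ¬ Isolated v z
    ¬isolated (inj₁ v≡z)       = v≢z v≡z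
    ¬isolated (inj₂ (v≢v , _)) = v≢v refl

    conclude : ∃[ x ] ∃[ y ] Separated (Class X S′) (x ∷ y ∷ T)
    conclude with separated-extend E.isEquivalence isolated-equivalence Isolated⇒Class (class? X S) isolated?
                    separated vz ¬isolated
                | separate-or-equal isolated-equivalence E′.isEquivalence Class′⇒Isolated isolated? (class? X S′)
    ... | y , separated₁ | inj₁ (a , b , ab , ¬ab) =
      let x , separated₂ = separated-extend isolated-equivalence E′.isEquivalence Class′⇒Isolated
                             isolated? (class? X S′) separated₁ ab ¬ab
      in x , y , separated₂
    ... | _ | inj₂ equal = contradiction
      (isolated⇒twins (class? X S) (class-equitable X S) (class-equitable X S′) single-v
        (λ x≢v y≢v xy → equal (inj₂ (x≢v , y≢v , xy))) v≢z vz)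
      (noTwins v≢z)

  -- Each individualized vertex adds two representatives, of which there can be at most n. The
  -- process stops only when every class is a singleton.
  half-suffices : ∃[ S ] 2 * ∣ S ∣ ≤ n × (∀ {u v} → Class X S u v → u ≡ v)
  half-suffices = search (suc n) Subset.⊥ [] (ℕ.m≤m+n (suc n) 0) (ℕ.≤-reflexive (cong (2 *_) (Subset.∣⊥∣≡0 n))) []
    where
    search : ∀ fuel S T → n < fuel + length T → 2 * ∣ S ∣ ≤ length T → Separated (Class X S) T →
             ∃[ S ] 2 * ∣ S ∣ ≤ n × (∀ {u v} → Class X S u v → u ≡ v)
    search zero S T n< S≤T separated = contradiction
      (ℕ.≤-trans n< (separated-length (Equitable.isEquivalence (class-equitable X S)) separated)) (ℕ.<-irrefl refl)
    search (suc fuel) S T n< S≤T separated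
      with separate-or-equal (Equitable.isEquivalence (class-equitable X S)) ≡.isEquivalence
             (λ { refl → Equitable.Eq.refl (class-equitable X S) }) (class? X S) Fin._≟_
    ... | inj₂ trivial = S , ℕ.≤-trans S≤T (separated-length (Equitable.isEquivalence (class-equitable X S)) separated) , trivial
    ... | inj₁ (v , z , vz , v≢z) =
      let x , y , separated′ = two-more-classes separated v≢z vz
      in search fuel (S ∪ ⁅ v ⁆) (x ∷ y ∷ T)
           (ℕ.≤-trans n< (ℕ.≤-trans (ℕ.≤-reflexive (sym (ℕ.+-suc fuel _))) (ℕ.+-monoʳ-≤ fuel (ℕ.n≤1+n _))))
           (grow v) separated′
      where
      grow : ∀ v → 2 * ∣ S ∪ ⁅ v ⁆ ∣ ≤ suc (suc (length T))
      grow v = begin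
        2 * ∣ S ∪ ⁅ v ⁆ ∣         ≤⟨ ℕ.*-monoʳ-≤ 2 (∣p∪q∣≤∣p∣+∣q∣ S ⁅ v ⁆) ⟩
        2 * (∣ S ∣ + ∣ ⁅ v ⁆ ∣)   ≡⟨ ℕ.*-distribˡ-+ 2 ∣ S ∣ ∣ ⁅ v ⁆ ∣ ⟩
        2 * ∣ S ∣ + 2 * ∣ ⁅ v ⁆ ∣ ≡⟨ cong (λ k → 2 * ∣ S ∣ + 2 * k) (Subset.∣⁅x⁆∣≡1 v) ⟩
        2 * ∣ S ∣ + 2             ≤⟨ ℕ.+-monoˡ-≤ 2 S≤T ⟩
        length T + 2              ≡⟨ ℕ.+-comm (length T) 2 ⟩
        suc (suc (length T))      ∎
        where open ℕ.≤-Reasoning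

  -- At most half of the vertices need to be individualized, so at least k others remain. Any k of
  -- these may be spared, as it does no harm to individualize the rest too.
  half-determined : ∀ k → 2 * k ≤ n → Σ[ W ∈ List (Fin n) ] Unique W × length W ≡ k × Determined X W
  half-determined k 2k≤n with half-suffices
  ... | S , 2S≤n , trivial = take k W , Unique.take⁺ k (Unique-filterᵇ free (Unique.allFin⁺ n)) ,
    trans (List.length-take k W) (ℕ.m≤n⇒m⊓n≡m k≤W) , Determined-⊆ {X = X} take⊆ determined
    where
    free : Fin n → Bool
    free = not ∘ Vec.lookup S

    W = filterᵇ free (allFin n)

    complement : ∣ S ∣ + length W ≡ n
    complement = subst (λ S′ → ∣ S′ ∣ + length W ≡ n) (Vec.tabulate∘lookup S) (∣tabulate∣+filter-not (Vec.lookup S) id)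

    k≤W : k ≤ length W
    k≤W = ℕ.+-cancelˡ-≤ ∣ S ∣ k (length W) (subst (∣ S ∣ + k ≤_) (sym complement)
      (ℕ.*-cancelˡ-≤ 2 (begin
        2 * (∣ S ∣ + k)     ≡⟨ ℕ.*-distribˡ-+ 2 ∣ S ∣ k ⟩
        2 * ∣ S ∣ + 2 * k   ≤⟨ ℕ.+-mono-≤ 2S≤n 2k≤n ⟩
        n + n               ≡⟨ cong (n +_) (ℕ.+-identityʳ n) ⟨
        2 * n               ∎)))
      where open ℕ.≤-Reasoning

    take⊆ : take k W ⊆ W
    take⊆ x∈ = subst (_ ∈_) (List.take++drop≡id k W) (∈-++⁺ˡ x∈)

    determined : Determined X W
    determined E equitable single uv = trivial (class-coarsest X S equitable (λ {x} x∈S → single (λ x∈W →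
      contradiction (trans (sym (cong not (Vec.[]=⇒lookup x∈S))) (proj₂ (∈-filterᵇ⁻ free {allFin n} x∈W))) (λ ()))) uv)

module _ {n} (X : ColoredGraph n) where

  private
    ι = lookup (kept X)

  -- Deleted vertices cannot tell the two apart either, since adjacency to them is part of the new
  -- color.
  twins-ι : ∀ {i j} → Twins (twinFree X) i j → Twins X (ι i) (ι j)
  twins-ι {i} {j} (mkTwins colors adjs) = mkTwins (proj₁ distinctions) same
    where
    distinctions = newColor-injective X {ι i} {ι j} colors

    same : ∀ w → w ≢ ι i → w ≢ ι j → adj X (ι i) w ≡ adj X (ι j) w
    same w w≢i w≢j with isKept X w Bool.≟ true
    ... | no ¬kept = trans (symmetric X (ι i) w) (trans (proj₂ distinctions w (Bool.¬-not ¬kept)) (symmetric X w (ι j)))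
    ... | yes kept-w with ι-surjective X kept-w
    ...   | l , refl = adjs l (λ l≡i → w≢i (cong ι l≡i)) (λ l≡j → w≢j (cong ι l≡j))

  -- Of two twins in `X` the earlier one is deleted, so they are never both kept.
  twinFree-noTwins : ∀ {i j} → i ≢ j → ¬ Twins (twinFree X) i j
  twinFree-noTwins {i} {j} i≢j twins with Fin.<-cmp (ι i) (ι j)
  ... | tri< i<j _ _ = kept⇒no-later-twin X (ι-kept X i) i<j (twins-ι twins)
  ... | tri≈ _ eq _  = i≢j (ι-injective X eq)
  ... | tri> _ _ j<i = kept⇒no-later-twin X (ι-kept X j) j<i (twins-sym X (twins-ι twins))

  unmap-ι : ∀ {W} → AllKept X W → ∃[ V ] map ι V ≡ W
  unmap-ι []               = [] , refl
  unmap-ι (kept-w ∷ kept-W) = let i , i≡ = ι-surjective X kept-w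
                                  V , V≡ = unmap-ι kept-W
                              in i ∷ V , cong₂ _∷_ i≡ V≡

-- Correctness of the kernelization

<ᵇ-⌊/2⌋ : ∀ k m → (k <ᵇ suc ⌊ m /2⌋) ≡ (2 * k <ᵇ suc m)
<ᵇ-⌊/2⌋ zero    m             = refl
<ᵇ-⌊/2⌋ (suc k) zero          = refl
<ᵇ-⌊/2⌋ (suc k) (suc zero)    rewrite ℕ.+-suc k (k + 0) = refl
<ᵇ-⌊/2⌋ (suc k) (suc (suc m)) rewrite ℕ.+-suc k (k + 0) = <ᵇ-⌊/2⌋ k m

-- Once the spared vertices are exchanged for kept ones, their list is the image of a list of
-- vertices of the kernel.
solvable⇒reduced : ∀ I → Solvable I → Solvable (reduced I)
solvable⇒reduced I (W , unique , length≡ , determined)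
  with exchange (graph I) W {[]} [] (subst Unique (sym (List.++-identityʳ W)) unique)
         (subst (Determined (graph I)) (sym (List.++-identityʳ W)) determined)
... | W′ , kept-W′ , unique′ , length′ , determined′ with unmap-ι (graph I) kept-W′
... | V , refl = V , Unique.map⁻ unique′ ,
  trans (sym (List.length-map _ V)) (trans length′ (trans (ℕ.+-identityʳ _) length≡)) ,
  determined-twinFree⁻ (graph I) determined′

reduced⇒solvable : ∀ I → Solvable (reduced I) → Solvable I
reduced⇒solvable I (V , unique , length≡ , determined) =
  map _ V , Unique.map⁺ (ι-injective (graph I)) unique , trans (List.length-map _ V) length≡ ,
  determined-twinFree⁺ (graph I) determined

trivial-yes : ∀ I → YesInstance (trivial I)
trivial-yes I = solvable⇒yes (trivial I) ([] , [] , refl , λ { _ _ _ {()} })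

κ-kernelization : Kernelization (λ k → 2 * k) κ
κ-kernelization = record { equivalent = equivalent ; bounded = bounded }
  where
  equivalent : ∀ I → YesInstance I ⇔ YesInstance (κ I)
  equivalent I with param I <ᵇ suc ⌊ length (kept (graph I)) /2⌋ in small
  ... | false = mk⇔ (λ yes-I → solvable⇒yes (reduced I) (solvable⇒reduced I (yes⇒solvable I yes-I)))
                    (λ yes-κI → solvable⇒yes I (reduced⇒solvable I (yes⇒solvable (reduced I) yes-κI)))
  ... | true  = mk⇔ (λ _ → trivial-yes I) (λ _ → solvable⇒yes I (reduced⇒solvable I
    (half-determined (twinFree (graph I)) (twinFree-noTwins (graph I)) (param I)
      (ℕ.≤-pred (ℕ.<ᵇ⇒< _ _ (Equivalence.from Bool.T-≡ (trans (sym (<ᵇ-⌊/2⌋ (param I) _)) small)))))))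

  bounded : ∀ I → order (κ I) ≤ 2 * param I
  bounded I with param I <ᵇ suc ⌊ length (kept (graph I)) /2⌋ in small
  ... | true  = z≤n
  ... | false = ℕ.≮⇒≥ (λ 2k<m → contradiction
    (trans (sym (Equivalence.to Bool.T-≡ (ℕ.<⇒<ᵇ (ℕ.m≤n⇒m≤1+n 2k<m)))) (trans (sym (<ᵇ-⌊/2⌋ (param I) _)) small)) (λ ()))

-- Polynomial-time programs

-- Bounds are kept as syntax with natural coefficients: all of them are monotone and closed under
-- composition, which is what sequencing needs. The form a * n ^ d is reached only at the very end.
data Poly : Set where
  con     : ℕ → Poly
  arg     : Poly
  _⊕_ _⊗_ : Poly → Poly → Poly

infixr 6 _⊕_
infixr 7 _⊗_
infixr 8 _∘ₚ_

⟦_⟧ : Poly → ℕ → ℕ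
⟦ con c ⟧ n = c
⟦ arg   ⟧ n = n
⟦ P ⊕ Q ⟧ n = ⟦ P ⟧ n + ⟦ Q ⟧ n
⟦ P ⊗ Q ⟧ n = ⟦ P ⟧ n * ⟦ Q ⟧ n

⟦⟧-mono : ∀ P {m n} → m ≤ n → ⟦ P ⟧ m ≤ ⟦ P ⟧ n
⟦⟧-mono (con c) m≤n = ℕ.≤-refl
⟦⟧-mono arg     m≤n = m≤n
⟦⟧-mono (P ⊕ Q) m≤n = ℕ.+-mono-≤ (⟦⟧-mono P m≤n) (⟦⟧-mono Q m≤n)
⟦⟧-mono (P ⊗ Q) m≤n = ℕ.*-mono-≤ (⟦⟧-mono P m≤n) (⟦⟧-mono Q m≤n)

_∘ₚ_ : Poly → Poly → Poly
con c   ∘ₚ R = con c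
arg     ∘ₚ R = R
(P ⊕ Q) ∘ₚ R = (P ∘ₚ R) ⊕ (Q ∘ₚ R)
(P ⊗ Q) ∘ₚ R = (P ∘ₚ R) ⊗ (Q ∘ₚ R)

⟦∘ₚ⟧ : ∀ P R n → ⟦ P ∘ₚ R ⟧ n ≡ ⟦ P ⟧ (⟦ R ⟧ n)
⟦∘ₚ⟧ (con c) R n = refl
⟦∘ₚ⟧ arg     R n = refl
⟦∘ₚ⟧ (P ⊕ Q) R n = cong₂ _+_ (⟦∘ₚ⟧ P R n) (⟦∘ₚ⟧ Q R n)
⟦∘ₚ⟧ (P ⊗ Q) R n = cong₂ _*_ (⟦∘ₚ⟧ P R n) (⟦∘ₚ⟧ Q R n)

⟦∘ₚ⟧-bound : ∀ P R {m n} → m ≤ ⟦ R ⟧ n → ⟦ P ⟧ m ≤ ⟦ P ∘ₚ R ⟧ n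
⟦∘ₚ⟧-bound P R {n = n} m≤ = ℕ.≤-trans (⟦⟧-mono P m≤) (ℕ.≤-reflexive (sym (⟦∘ₚ⟧ P R n)))

-- Exponents are added even for a sum, in place of their maximum. Raising an exponent requires n ≥
-- 1, which is true of the size of a tree.
monomial-bound : ∀ P → ∃[ a ] ∃[ d ] (∀ n → .{{NonZero n}} → ⟦ P ⟧ n ≤ a * n ^ d)
monomial-bound (con c) = c , 0 , λ n → ℕ.≤-reflexive (sym (ℕ.*-identityʳ c))
monomial-bound arg = 1 , 1 , λ n →
  ℕ.≤-reflexive (sym (trans (ℕ.*-identityˡ (n * 1)) (ℕ.*-identityʳ n)))
monomial-bound (P ⊕ Q) with monomial-bound P | monomial-bound Q
... | a , d , P≤ | b , e , Q≤ = a + b , d + e , λ n → begin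
  ⟦ P ⟧ n + ⟦ Q ⟧ n                  ≤⟨ ℕ.+-mono-≤ (P≤ n) (Q≤ n) ⟩
  a * n ^ d + b * n ^ e              ≤⟨ ℕ.+-mono-≤ (ℕ.*-monoʳ-≤ a (ℕ.^-monoʳ-≤ n (ℕ.m≤m+n d e)))
                                                   (ℕ.*-monoʳ-≤ b (ℕ.^-monoʳ-≤ n (ℕ.m≤n+m e d))) ⟩
  a * n ^ (d + e) + b * n ^ (d + e)  ≡⟨ ℕ.*-distribʳ-+ (n ^ (d + e)) a b ⟨
  (a + b) * n ^ (d + e)              ∎
  where open ℕ.≤-Reasoning
monomial-bound (P ⊗ Q) with monomial-bound P | monomial-bound Q
... | a , d , P≤ | b , e , Q≤ = a * b , d + e , λ n → begin
  ⟦ P ⟧ n * ⟦ Q ⟧ n          ≤⟨ ℕ.*-mono-≤ (P≤ n) (Q≤ n) ⟩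
  a * n ^ d * (b * n ^ e)    ≡⟨ ℕ.[m*n]*[o*p]≡[m*o]*[n*p] a (n ^ d) b (n ^ e) ⟩
  a * b * (n ^ d * n ^ e)    ≡⟨ cong (a * b *_) (ℕ.^-distribˡ-+-* n d e) ⟨
  a * b * n ^ (d + e)        ∎
  where open ℕ.≤-Reasoning

-- Programs keep their value in variable 0 and a stack in variable 1, which
-- they leave as it was; every other variable is scratch space.
record Run (p : Cmd) (σ : Store) (out : Tree) (bound : ℕ) : Set where
  constructor mkRun
  field
    {final} : Store
    {steps} : ℕ
    exec    : ⟨ p , σ ⟩⇓ final ∣ steps
    result  : final 0 ≡ out
    stack   : final 1 ≡ σ 1
    within  : steps ≤ bound

infix 4 _⟶_

-- The index set consists of the data that inp and out encode, so that inp acts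
-- as a context in which out is computed.
record _⟶_ {I : Set} (inp out : I → Tree) : Set where
  field
    prog  : Cmd
    time  : Poly
    space : Poly
    runs  : ∀ i σ → σ 0 ≡ inp i → Run prog σ (out i) (⟦ time ⟧ (size (inp i)))
    small : ∀ i → size (out i) ≤ ⟦ space ⟧ (size (inp i))

open _⟶_

size-nonZero : ∀ t → NonZero (size t)
size-nonZero nil        = _
size-nonZero (cons _ _) = _

polynomialTime : {A B : Set} {encA : A → Tree} {encB : B → Tree} {f : A → B} →
                 encA ⟶ encB ∘ f → PolynomialTime encA encB f
polynomialTime {encA = encA} F with monomial-bound (F .time ⊕ F .space)
... | a , d , bound = F .prog , a , d , λ x →
  let mkRun {τ} {t} exec result _ within = F .runs x (initial (encA x)) refl
      n    = size (encA x)
      both = bound n {{size-nonZero (encA x)}}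
  in τ , t , exec , result ,
     ℕ.≤-trans within (ℕ.≤-trans (ℕ.m≤m+n _ _) both) ,
     ℕ.≤-trans (ℕ.≤-reflexive (cong size result))
               (ℕ.≤-trans (F .small x) (ℕ.≤-trans (ℕ.m≤n+m _ _) both))

size-head : ∀ t → size (head t) ≤ size t
size-head nil        = ℕ.≤-refl
size-head (cons s t) = ℕ.m≤n⇒m≤1+n (ℕ.m≤m+n _ _)

size-tail : ∀ t → size (tail t) ≤ size t
size-tail nil        = ℕ.≤-refl
size-tail (cons s t) = ℕ.m≤n⇒m≤1+n (ℕ.m≤n+m _ _)

isCons : Tree → Bool
isCons nil        = false
isCons (cons _ _) = true

-- Sequencing, pairing and branching

module _ {I : Set} where

  expr : {inp out : I → Tree} (e : Expr) (P : Poly) →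
         (∀ i σ → σ 0 ≡ inp i → eval e σ ≡ out i) →
         (∀ i → size (out i) ≤ ⟦ P ⟧ (size (inp i))) →
         inp ⟶ out
  expr e P correct bound = record
    { prog  = 0 := e
    ; time  = con (suc (cost e))
    ; space = P
    ; runs  = λ i σ eq → mkRun assign (correct i σ eq) refl ℕ.≤-refl
    ; small = bound
    }

  cast : {inp out out′ : I → Tree} → (∀ i → out i ≡ out′ i) → inp ⟶ out → inp ⟶ out′
  cast eq F = record
    { prog  = F .prog
    ; time  = F .time
    ; space = F .space
    ; runs  = λ i σ start → let mkRun exec result stack within = F .runs i σ start
                            in mkRun exec (trans result (eq i)) stack within
    ; small = λ i → subst (λ t → size t ≤ ⟦ F .space ⟧ _) (eq i) (F .small i)
    }

  infixr 5 _⨟_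

  _⨟_ : {inp mid out : I → Tree} → inp ⟶ mid → mid ⟶ out → inp ⟶ out
  F ⨟ G = record
    { prog  = F .prog ⨾ G .prog
    ; time  = F .time ⊕ (G .time ∘ₚ F .space)
    ; space = G .space ∘ₚ F .space
    ; runs  = λ i σ start →
        let mkRun exec₁ result₁ stack₁ within₁ = F .runs i σ start
            mkRun exec₂ result₂ stack₂ within₂ = G .runs i _ result₁
        in mkRun (seq exec₁ exec₂) result₂ (trans stack₂ stack₁)
             (ℕ.+-mono-≤ within₁ (ℕ.≤-trans within₂ (⟦∘ₚ⟧-bound (G .time) (F .space) (F .small i))))
    ; small = λ i → ℕ.≤-trans (G .small i) (⟦∘ₚ⟧-bound (G .space) (F .space) (F .small i))
    }

  identity : {inp : I → Tree} → inp ⟶ inp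
  identity = expr (var 0) arg (λ _ _ eq → eq) (λ _ → ℕ.≤-refl)

  const : {inp : I → Tree} (t : Tree) → inp ⟶ (λ _ → t)
  const t = expr (quoted t) (con (size t)) (λ _ σ _ → eval-quoted t σ) (λ _ → ℕ.≤-refl)
    where
    quoted : Tree → Expr
    quoted nil        = nil
    quoted (cons s t) = cons (quoted s) (quoted t)

    eval-quoted : ∀ t σ → eval (quoted t) σ ≡ t
    eval-quoted nil        σ = refl
    eval-quoted (cons s t) σ = cong₂ cons (eval-quoted s σ) (eval-quoted t σ)

  headR : {inp out : I → Tree} → inp ⟶ out → inp ⟶ (head ∘ out)
  headR F = F ⨟ expr (hd (var 0)) arg (λ _ _ → cong head) (λ _ → size-head _)

  tailR : {inp out : I → Tree} → inp ⟶ out → inp ⟶ (tail ∘ out)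
  tailR F = F ⨟ expr (tl (var 0)) arg (λ _ _ → cong tail) (λ _ → size-tail _)

  consR : {inp a b : I → Tree} → inp ⟶ a → inp ⟶ b → inp ⟶ (λ i → cons (a i) (b i))
  consR {inp} {a} {b} F G = record
    -- The input waits on the stack while `F` runs. Then the result of `F` takes its place there,
    -- and variable 2 hands the input over to `G`; no run takes place while variable 2 is in use.
    { prog  = 1 := cons (var 0) (var 1) ⨾ F .prog ⨾ 2 := hd (var 1) ⨾
              1 := cons (var 0) (tl (var 1)) ⨾ 0 := var 2 ⨾ G .prog ⨾
              0 := cons (hd (var 1)) (var 0) ⨾ 1 := tl (var 1)
    -- The constants are the costs of the assignments in their order, 8 being that of the last two
    -- together.
    ; time  = con 4 ⊕ F .time ⊕ con 3 ⊕ con 5 ⊕ con 2 ⊕ G .time ⊕ con 8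
    ; space = con 1 ⊕ F .space ⊕ G .space
    ; runs  = go
    ; small = λ i → s≤s (ℕ.+-mono-≤ (F .small i) (G .small i))
    }
    where
    go : ∀ i σ → σ 0 ≡ inp i → Run _ σ (cons (a i) (b i)) _
    go i σ start with F .runs i (σ [ 1 ↦ cons (σ 0) (σ 1) ]) start
    ... | mkRun {τ} exec₁ result₁ stack₁ within₁
      with G .runs i (τ [ 2 ↦ head (τ 1) ] [ 1 ↦ cons (τ 0) (tail (τ 1)) ] [ 0 ↦ head (τ 1) ])
             (trans (cong head stack₁) start)
    ... | mkRun exec₂ result₂ stack₂ within₂ = mkRun
      (seq assign (seq exec₁ (seq assign (seq assign (seq assign (seq exec₂ (seq assign assign)))))))
      (cong₂ cons (trans (cong head stack₂) result₁) result₂)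
      (trans (cong tail stack₂) (cong tail stack₁))
      (ℕ.+-monoʳ-≤ 4 (ℕ.+-mono-≤ within₁ (ℕ.+-monoʳ-≤ 3 (ℕ.+-monoʳ-≤ 5 (ℕ.+-monoʳ-≤ 2
        (ℕ.+-mono-≤ within₂ ℕ.≤-refl))))))

  private
    choose : {x y z : I → Tree} (b : I → Bool) → x ⟶ y → x ⟶ z →
             (λ i → cons (encodeBool (b i)) (x i)) ⟶ (λ i → if b i then y i else z i)
    choose {x} {y} {z} b F G = record
      { prog  = test hd (var 0) then (0 := tl (var 0) ⨾ F .prog) else (0 := tl (var 0) ⨾ G .prog)
      -- There is no maximum in `Poly`, so the sum has to cover either branch.
      ; time  = con 3 ⊕ con 3 ⊕ (F .time ⊕ G .time)
      ; space = F .space ⊕ G .space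
      ; runs  = go
      ; small = bound
      }
      where
      smaller : ∀ i → size (x i) ≤ size (cons (encodeBool (b i)) (x i))
      smaller i = size-tail (cons (encodeBool (b i)) (x i))

      bound : ∀ i → size (if b i then y i else z i) ≤
              ⟦ F .space ⊕ G .space ⟧ (size (cons (encodeBool (b i)) (x i)))
      bound i with b i | smaller i
      ... | true  | le = ℕ.≤-trans (F .small i) (ℕ.≤-trans (⟦⟧-mono (F .space) le) (ℕ.m≤m+n _ _))
      ... | false | le = ℕ.≤-trans (G .small i) (ℕ.≤-trans (⟦⟧-mono (G .space) le) (ℕ.m≤n+m _ _))

      go : ∀ i σ → σ 0 ≡ cons (encodeBool (b i)) (x i) → Run _ σ (if b i then y i else z i)
           (⟦ con 3 ⊕ con 3 ⊕ (F .time ⊕ G .time) ⟧ (size (cons (encodeBool (b i)) (x i))))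
      go i σ start with b i | smaller i
      ... | true  | le =
        let mkRun exec result stack within = F .runs i (σ [ 0 ↦ tail (σ 0) ]) (cong tail start)
        in mkRun (then- (cong head start) (seq assign exec)) result stack
             (ℕ.+-monoʳ-≤ 3 (ℕ.+-monoʳ-≤ 3
               (ℕ.≤-trans within (ℕ.≤-trans (⟦⟧-mono (F .time) le) (ℕ.m≤m+n _ _)))))
      ... | false | le =
        let mkRun exec result stack within = G .runs i (σ [ 0 ↦ tail (σ 0) ]) (cong tail start)
        in mkRun (else- (cong head start) (seq assign exec)) result stack
             (ℕ.+-monoʳ-≤ 3 (ℕ.+-monoʳ-≤ 3
               (ℕ.≤-trans within (ℕ.≤-trans (⟦⟧-mono (G .time) le) (ℕ.m≤n+m _ _)))))

  ifR : {x y z : I → Tree} {b : I → Bool} → x ⟶ (encodeBool ∘ b) → x ⟶ y → x ⟶ z →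
        x ⟶ (λ i → if b i then y i else z i)
  ifR {b = b} B F G = consR B identity ⨟ choose b F G

  isConsR : {inp out : I → Tree} → inp ⟶ out → inp ⟶ (encodeBool ∘ isCons ∘ out)
  isConsR {out = out} F = F ⨟ record
    { prog  = test var 0 then (0 := cons nil nil) else (0 := nil)
    ; time  = con 6
    ; space = con 3
    ; runs  = go
    ; small = bound
    }
    where
    bound : ∀ i → size (encodeBool (isCons (out i))) ≤ 3
    bound i with out i
    ... | nil      = s≤s z≤n
    ... | cons _ _ = ℕ.≤-refl

    go : ∀ i σ → σ 0 ≡ out i → Run _ σ (encodeBool (isCons (out i))) 6
    go i σ start with out i
    ... | nil      = mkRun (else- start assign) refl refl (ℕ.m≤m+n 4 2)
    ... | cons _ _ = mkRun (then- start assign) refl refl ℕ.≤-refl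

-- Loops over lists

size-encodeList : {A : Set} (enc : A → Tree) (l : List A) → length l ≤ size (encodeList enc l)
size-encodeList enc []      = z≤n
size-encodeList enc (a ∷ l) = s≤s (ℕ.≤-trans (size-encodeList enc l) (ℕ.m≤n+m _ _))

module _ {I : Set} {inp : I → Tree} {A B : I → Set} (enc : ∀ i → A i → Tree) (encB : ∀ i → B i → Tree)
         (f : ∀ i → A i → B i → B i) where

  StepR : Set
  StepR = _⟶_ {Σ[ i ∈ I ] A i × B i} (λ (i , a , b) → cons (cons (inp i) (enc i a)) (encB i b))
                                     (λ (i , a , b) → encB i (f i a b))

  -- A step of a loop may increase the accumulator only by an amount that does
  -- not depend on the accumulator: otherwise its size could grow exponentially.
  Additive : Poly → Set
  Additive Q = ∀ i a b → size (encB i (f i a b)) ≤ size (encB i b) + ⟦ Q ⟧ (size (cons (inp i) (enc i a)))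

  module _ (F : StepR) (Q : Poly) (additive : Additive Q) where

    private
      -- Variable 0 holds the context, the remaining list and the accumulator. During the body the
      -- context and the rest of the list wait on the stack, and `F` sees the context extended by
      -- the current item, together with the accumulator.
      W : Cmd
      W = while hd (tl (var 0)) run
            (1 := cons (cons (hd (var 0)) (tl (hd (tl (var 0))))) (var 1) ⨾
             0 := cons (cons (hd (var 0)) (hd (hd (tl (var 0))))) (tl (tl (var 0))) ⨾
             F .prog ⨾
             0 := cons (hd (hd (var 1))) (cons (tl (hd (var 1))) (var 0)) ⨾
             1 := tl (var 1))

      -- The summands are the costs of the loop test and of the commands of the body.
      roundCost : ℕ → ℕ
      roundCost bodyTime = 4 + (10 + (12 + (bodyTime + 13)))

      state : ∀ i → List (A i) → B i → Tree
      state i l b = cons (inp i) (cons (encodeList (enc i) l) (encB i b))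

      result-of : ∀ i → List (A i) → B i → B i
      result-of i l b = foldl (flip (f i)) b l

      module _ (i : I) (s : ℕ) where

        context-bound : ∀ a l → suc (size (inp i) + size (encodeList (enc i) (a ∷ l))) ≤ s →
                        size (cons (inp i) (enc i a)) ≤ s
        context-bound a l le = ℕ.≤-trans
          (s≤s (ℕ.+-monoʳ-≤ (size (inp i)) (size-head (encodeList (enc i) (a ∷ l))))) le

        rest-bound : ∀ a l → suc (size (inp i) + size (encodeList (enc i) (a ∷ l))) ≤ s →
                     suc (size (inp i) + size (encodeList (enc i) l)) ≤ s
        rest-bound a l le = ℕ.≤-trans
          (s≤s (ℕ.+-monoʳ-≤ (size (inp i)) (size-tail (encodeList (enc i) (a ∷ l))))) le

        acc-bound : ∀ a l b → suc (size (inp i) + size (encodeList (enc i) (a ∷ l))) ≤ s →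
                    size (encB i (f i a b)) + length l * ⟦ Q ⟧ s ≤
                    size (encB i b) + length (a ∷ l) * ⟦ Q ⟧ s
        acc-bound a l b le = ℕ.≤-trans
          (ℕ.+-monoˡ-≤ _ (ℕ.≤-trans (additive i a b)
            (ℕ.+-monoʳ-≤ (size (encB i b)) (⟦⟧-mono Q (context-bound a l le)))))
          (ℕ.≤-reflexive (ℕ.+-assoc (size (encB i b)) (⟦ Q ⟧ s) _))

        fold-size : ∀ l b → suc (size (inp i) + size (encodeList (enc i) l)) ≤ s →
                    size (encB i (result-of i l b)) ≤ size (encB i b) + length l * ⟦ Q ⟧ s
        fold-size []      b le = ℕ.m≤m+n _ _
        fold-size (a ∷ l) b le =
          ℕ.≤-trans (fold-size l (f i a b) (rest-bound a l le)) (acc-bound a l b le)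

        module _ (M : ℕ) where

          bodyTime : ℕ
          bodyTime = ⟦ F .time ⟧ (suc (s + M))

          -- The size `s` bounds the context with any item, `M` bounds the accumulator at all times:
          -- the last hypothesis reserves an increase by ⟦ Q ⟧ s for each remaining round. Hence one
          -- time bound fits every round.
          iterate : ∀ l b σ → σ 0 ≡ state i l b →
                    suc (size (inp i) + size (encodeList (enc i) l)) ≤ s →
                    size (encB i b) + length l * ⟦ Q ⟧ s ≤ M →
                    Run W σ (state i [] (result-of i l b)) (length l * roundCost bodyTime + 4)
          iterate []      b σ start le accumulator = mkRun (stop (cong (head ∘ tail) start)) start refl ℕ.≤-refl
          iterate (a ∷ l) b σ start le accumulator
            with F .runs (i , a , b)
                   (σ [ 1 ↦ cons (cons (head (σ 0)) (tail (head (tail (σ 0))))) (σ 1) ]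
                      [ 0 ↦ cons (cons (head (σ 0)) (head (head (tail (σ 0))))) (tail (tail (σ 0))) ])
                   (cong (λ t → cons (cons (head t) (head (head (tail t)))) (tail (tail t))) start)
          ... | mkRun {τ} exec₁ result₁ stack₁ within₁
            with iterate l (f i a b)
                   (τ [ 0 ↦ cons (head (head (τ 1))) (cons (tail (head (τ 1))) (τ 0)) ] [ 1 ↦ tail (τ 1) ])
                   (cong₂ (λ h t → cons (head h) (cons (tail h) t))
                     (trans (cong head stack₁) (cong (λ t → cons (head t) (tail (head (tail t)))) start))
                     result₁)
                   (rest-bound a l le)
                   (ℕ.≤-trans (acc-bound a l b le) accumulator)
          ... | mkRun exec₂ result₂ stack₂ within₂ = mkRun
            (loop (cong (head ∘ tail) start)
                  (seq assign (seq assign (seq exec₁ (seq assign assign)))) exec₂)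
            result₂
            (trans stack₂ (cong tail stack₁))
            (ℕ.≤-trans
              (ℕ.+-monoʳ-≤ 4 (ℕ.+-mono-≤
                (ℕ.+-monoʳ-≤ 10 (ℕ.+-monoʳ-≤ 12 (ℕ.+-monoˡ-≤ 13 (ℕ.≤-trans within₁
                  (⟦⟧-mono (F .time) (s≤s (ℕ.+-mono-≤ (context-bound a l le)
                    (ℕ.≤-trans (ℕ.m≤m+n _ _) accumulator))))))))
                within₂))
              (ℕ.≤-reflexive (trans (sym (ℕ.+-assoc 4 (10 + (12 + (bodyTime + 13))) _))
                                    (sym (ℕ.+-assoc (roundCost bodyTime) (length l * roundCost bodyTime) 4)))))

    foldlR : (l : ∀ i → List (A i)) (z : ∀ i → B i) →
             (λ i → cons (inp i) (cons (encodeList (enc i) (l i)) (encB i (z i)))) ⟶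
             (λ i → encB i (foldl (flip (f i)) (z i) (l i)))
    foldlR l z = record
      { prog  = W ⨾ 0 := tl (tl (var 0))
      -- The list has at most as many items as its encoding has size. The last two constants are the
      -- failing loop test and the extraction of the accumulator.
      ; time  = (arg ⊗ (con 4 ⊕ con 10 ⊕ con 12 ⊕ (F .time ∘ₚ (con 1 ⊕ arg ⊕ M)) ⊕ con 13) ⊕ con 4) ⊕ con 4
      ; space = M
      ; runs  = go
      ; small = λ i → ℕ.≤-trans (fold-size i _ (l i) (z i) (list≤ i)) (acc≤ i)
      }
      where
      M : Poly
      M = arg ⊕ arg ⊗ Q

      N : I → ℕ
      N i = size (state i (l i) (z i))

      list≤ : ∀ i → suc (size (inp i) + size (encodeList (enc i) (l i))) ≤ N i
      list≤ i = s≤s (ℕ.+-monoʳ-≤ (size (inp i)) (size-head (cons (encodeList (enc i) (l i)) (encB i (z i)))))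

      length≤ : ∀ i → length (l i) ≤ N i
      length≤ i = ℕ.≤-trans (size-encodeList (enc i) (l i)) (ℕ.≤-trans (ℕ.m≤n+m _ (suc (size (inp i)))) (list≤ i))

      acc≤ : ∀ i → size (encB i (z i)) + length (l i) * ⟦ Q ⟧ (N i) ≤ ⟦ M ⟧ (N i)
      acc≤ i = ℕ.+-mono-≤
        (ℕ.≤-trans (size-tail (cons (encodeList (enc i) (l i)) (encB i (z i)))) (size-tail (state i (l i) (z i))))
        (ℕ.*-monoˡ-≤ (⟦ Q ⟧ (N i)) (length≤ i))

      go : ∀ i σ → σ 0 ≡ state i (l i) (z i) → Run _ σ (encB i (result-of i (l i) (z i))) _
      go i σ start =
        let mkRun exec result stack within =
              iterate i (N i) (⟦ M ⟧ (N i)) (l i) (z i) σ start (list≤ i) (acc≤ i)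
        in mkRun (seq exec assign) (cong (tail ∘ tail) result) stack
             (ℕ.+-monoˡ-≤ 4 (ℕ.≤-trans within (ℕ.+-monoˡ-≤ 4
               (ℕ.*-mono-≤ (length≤ i) (ℕ.+-monoʳ-≤ 4 (ℕ.+-monoʳ-≤ 10 (ℕ.+-monoʳ-≤ 12 (ℕ.+-monoˡ-≤ 13
                 (ℕ.≤-reflexive (sym (⟦∘ₚ⟧ (F .time) (con 1 ⊕ arg ⊕ M) (N i))))))))))))

-- Programs as typed terms in context

infix 4 _⊢_∶_

-- From the composite of `enc` and `a` unification could not recover the two; as indices of a record
-- they are inferred, so that programs can be written like terms.
record _⊢_∶_ {I : Set} (inp : I → Tree) {A : I → Set} (a : ∀ i → A i) (enc : ∀ i → A i → Tree) : Set where
  constructor ⟪_⟫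
  field
    program : inp ⟶ (λ i → enc i (a i))

open _⊢_∶_

private
  variable
    I I′  : Set
    A B C : I → Set
    inp   : I → Tree

encodePair : (I : Set) {A B : I → Set} → (∀ i → A i → Tree) → (∀ i → B i → Tree) →
             ∀ i → A i × B i → Tree
encodePair I encA encB i (a , b) = cons (encA i a) (encB i b)

-- Contexts grow to the right, as in de Bruijn notation.
_▹_ : (inp : I → Tree) (enc : ∀ i → A i → Tree) → Σ I A → Tree
(inp ▹ enc) (i , a) = cons (inp i) (enc i a)

raw : I → Tree → Tree
raw _ t = t

bool : I → Bool → Tree
bool _ = encodeBool

reindex : {a : ∀ i → A i} {enc : ∀ i → A i → Tree} (h : I′ → I) →
          inp ⊢ a ∶ enc → (λ j → inp (h j)) ⊢ (λ j → a (h j)) ∶ (λ j → enc (h j))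
reindex h ⟪ F ⟫ = ⟪ record
  { prog  = F .prog
  ; time  = F .time
  ; space = F .space
  ; runs  = λ j → F .runs (h j)
  ; small = λ j → F .small (h j)
  } ⟫

-- A change of view costs no steps: if two values have the same code, the same program computes
-- both.
recode : {a : ∀ i → A i} {b : ∀ i → B i} {encA : ∀ i → A i → Tree} {encB : ∀ i → B i → Tree} →
         (∀ i → encA i (a i) ≡ encB i (b i)) → inp ⊢ a ∶ encA → inp ⊢ b ∶ encB
recode eq ⟪ F ⟫ = ⟪ cast eq F ⟫

by : {a b : ∀ i → A i} {enc : ∀ i → A i → Tree} →
     (∀ i → a i ≡ b i) → inp ⊢ a ∶ enc → inp ⊢ b ∶ enc
by {enc = enc} eq = recode (λ i → cong (enc i) (eq i))

headOf : {t : I → Tree} → inp ⊢ t ∶ raw → inp ⊢ (λ i → head (t i)) ∶ raw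
headOf ⟪ F ⟫ = ⟪ headR F ⟫

tailOf : {t : I → Tree} → inp ⊢ t ∶ raw → inp ⊢ (λ i → tail (t i)) ∶ raw
tailOf ⟪ F ⟫ = ⟪ tailR F ⟫

pair : {a : ∀ i → A i} {b : ∀ i → B i} {encA : ∀ i → A i → Tree} {encB : ∀ i → B i → Tree} →
       inp ⊢ a ∶ encA → inp ⊢ b ∶ encB → inp ⊢ (λ i → a i , b i) ∶ encodePair I encA encB
pair ⟪ F ⟫ ⟪ G ⟫ = ⟪ consR F G ⟫

fst : {p : ∀ i → A i × B i} {encA : ∀ i → A i → Tree} {encB : ∀ i → B i → Tree} →
      inp ⊢ p ∶ encodePair I encA encB → inp ⊢ (λ i → proj₁ (p i)) ∶ encA
fst ⟪ F ⟫ = ⟪ headR F ⟫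

snd : {p : ∀ i → A i × B i} {encA : ∀ i → A i → Tree} {encB : ∀ i → B i → Tree} →
      inp ⊢ p ∶ encodePair I encA encB → inp ⊢ (λ i → proj₂ (p i)) ∶ encB
snd ⟪ F ⟫ = ⟪ tailR F ⟫

outer : {a : ∀ i → A i} {encA : ∀ i → A i → Tree} {encB : ∀ i → B i → Tree} →
        inp ⊢ a ∶ encA → inp ▹ encB ⊢ (λ (i , _) → a i) ∶ (λ (i , _) → encA i)
outer F = ⟪ headR identity ⨟ reindex proj₁ F .program ⟫

inner : {enc : ∀ i → A i → Tree} → inp ▹ enc ⊢ proj₂ ∶ (λ (i , _) → enc i)
inner = ⟪ tailR identity ⟫

if : {b : I → Bool} {x y : ∀ i → A i} {enc : ∀ i → A i → Tree} →
     inp ⊢ b ∶ bool → inp ⊢ x ∶ enc → inp ⊢ y ∶ enc → inp ⊢ (λ i → if b i then x i else y i) ∶ enc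
if {b = b} {enc = enc} ⟪ F ⟫ ⟪ G ⟫ ⟪ H ⟫ = ⟪ cast (λ i → distribute i (b i)) (ifR F G H) ⟫
  where
  distribute : ∀ i b {x y} → (if b then enc i x else enc i y) ≡ enc i (if b then x else y)
  distribute i true  = refl
  distribute i false = refl

always : inp ⊢ (λ _ → true) ∶ bool
always = ⟪ const (cons nil nil) ⟫

never : inp ⊢ (λ _ → false) ∶ bool
never = ⟪ const nil ⟫

not′ : {b : I → Bool} → inp ⊢ b ∶ bool → inp ⊢ (λ i → not (b i)) ∶ bool
not′ {b = b} F = by (λ i → eq (b i)) (if F never always)
  where
  eq : ∀ b → (if b then false else true) ≡ not b
  eq true  = refl
  eq false = refl

and : {b c : I → Bool} → inp ⊢ b ∶ bool → inp ⊢ c ∶ bool → inp ⊢ (λ i → b i ∧ c i) ∶ bool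
and {b = b} F G = by (λ i → eq (b i)) (if F G never)
  where
  eq : ∀ b {c} → (if b then c else false) ≡ b ∧ c
  eq true  = refl
  eq false = refl

or : {b c : I → Bool} → inp ⊢ b ∶ bool → inp ⊢ c ∶ bool → inp ⊢ (λ i → b i ∨ c i) ∶ bool
or {b = b} F G = by (λ i → eq (b i)) (if F always G)
  where
  eq : ∀ b {c} → (if b then true else c) ≡ b ∨ c
  eq true  = refl
  eq false = refl

agreeing : {b c : I → Bool} → inp ⊢ b ∶ bool → inp ⊢ c ∶ bool → inp ⊢ (λ i → agree (b i) (c i)) ∶ bool
agreeing F G = if F G (not′ G)

-- Lists

list : {A : I → Set} → (∀ i → A i → Tree) → ∀ i → List (A i) → Tree
list enc i = encodeList (enc i)

nil′ : {enc : ∀ i → A i → Tree} → inp ⊢ (λ _ → []) ∶ list enc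
nil′ = ⟪ const nil ⟫

cons′ : {a : ∀ i → A i} {as : ∀ i → List (A i)} {enc : ∀ i → A i → Tree} →
        inp ⊢ a ∶ enc → inp ⊢ as ∶ list enc → inp ⊢ (λ i → a i ∷ as i) ∶ list enc
cons′ ⟪ F ⟫ ⟪ G ⟫ = ⟪ consR F G ⟫

module _ {I : Set} {inp : I → Tree} {A B : I → Set} {enc : ∀ i → A i → Tree} (encB : ∀ i → B i → Tree) where

  stepContext : Σ[ i ∈ I ] A i × B i → Tree
  stepContext (i , a , b) = cons (cons (inp i) (enc i a)) (encB i b)

  item : stepContext ⊢ (λ (i , a , b) → a) ∶ (λ (i , _) → enc i)
  item = ⟪ tailR (headR identity) ⟫

  accumulator : stepContext ⊢ (λ (i , a , b) → b) ∶ (λ (i , _) → encB i)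
  accumulator = ⟪ tailR identity ⟫

  withItem : {a : ∀ ia → C ia} {encC : ∀ ia → C ia → Tree} → inp ▹ enc ⊢ a ∶ encC →
             stepContext ⊢ (λ (i , a′ , b) → a (i , a′)) ∶ (λ (i , a′ , b) → encC (i , a′))
  withItem F = ⟪ headR identity ⨟ reindex (λ (i , a , b) → i , a) F .program ⟫

module _ {I : Set} {inp : I → Tree} {A B : I → Set} {enc : ∀ i → A i → Tree} {l : ∀ i → List (A i)}
         (L : inp ⊢ l ∶ list enc) {encB : ∀ i → B i → Tree} (f : ∀ i → A i → B i → B i) where

  foldFromLeft : {z : ∀ i → B i} → inp ⊢ z ∶ encB →
                 stepContext {enc = enc} encB ⊢ (λ (i , a , b) → f i a b) ∶ (λ (i , _) → encB i) →
                 (Q : Poly) → Additive {inp = inp} enc encB f Q →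
                 inp ⊢ (λ i → foldl (flip (f i)) (z i) (l i)) ∶ encB
  foldFromLeft {z} ⟪ Z ⟫ ⟪ F ⟫ Q additive =
    ⟪ consR identity (consR (L .program) Z) ⨟ foldlR enc encB f F Q additive l z ⟫

additive-∷ : ∀ s t {u} → s ≤ u → suc (s + t) ≤ t + suc u
additive-∷ s t s≤u = ℕ.≤-trans (s≤s (ℕ.≤-trans (ℕ.≤-reflexive (ℕ.+-comm s t)) (ℕ.+-monoʳ-≤ t s≤u)))
                               (ℕ.≤-reflexive (sym (ℕ.+-suc t _)))

-- Loops consume a list from its front, so the right folds of the specifications are run as left
-- folds over the reversed list.
backwards : {enc : ∀ i → A i → Tree} {l : ∀ i → List (A i)} →
            inp ⊢ l ∶ list enc → inp ⊢ (λ i → reverse (l i)) ∶ list enc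
backwards {inp = inp} {enc = enc} L = foldFromLeft L (λ i → _∷_) nil′
  (cons′ (item {inp = inp} (list enc)) (accumulator {inp = inp} {enc = enc} (list enc))) arg
  (λ i a as → additive-∷ (size (enc i a)) _ (ℕ.m≤n+m _ _))

module _ {I : Set} {inp : I → Tree} {A B : I → Set} {enc : ∀ i → A i → Tree} {l : ∀ i → List (A i)}
         (L : inp ⊢ l ∶ list enc) {encB : ∀ i → B i → Tree} (f : ∀ i → A i → B i → B i) where

  fold : {z : ∀ i → B i} → inp ⊢ z ∶ encB →
         stepContext {enc = enc} encB ⊢ (λ (i , a , b) → f i a b) ∶ (λ (i , _) → encB i) →
         (Q : Poly) → Additive {inp = inp} enc encB f Q →
         inp ⊢ (λ i → foldr (f i) (z i) (l i)) ∶ encB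
  fold {z} Z F Q additive = by (λ i → List.reverse-foldl (flip (f i)) (z i) (l i))
                               (foldFromLeft (backwards L) f Z F Q additive)

size-encodeBool : ∀ b → size (encodeBool b) ≤ 3
size-encodeBool false = s≤s z≤n
size-encodeBool true  = ℕ.≤-refl

module _ {I : Set} {inp : I → Tree} {A : I → Set} {enc : ∀ i → A i → Tree} {l : ∀ i → List (A i)}
         (L : inp ⊢ l ∶ list enc) where

  mapping : {B : I → Set} {encB : ∀ i → B i → Tree} {g : ∀ i → A i → B i} →
            inp ▹ enc ⊢ (λ (i , a) → g i a) ∶ (λ (i , _) → encB i) →
            inp ⊢ (λ i → map (g i) (l i)) ∶ list encB
  mapping {encB = encB} {g} G = by (λ i → foldr-map i (l i))
    (fold L (λ i a → g i a ∷_) nil′ (cons′ (withItem (list encB) G) (accumulator {inp = inp} {enc = enc} (list encB)))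
      (con 1 ⊕ G .program .space) (λ i a bs → additive-∷ (size (encB i (g i a))) _ (G .program .small (i , a))))
    where
    foldr-map : ∀ i as → foldr (λ a → g i a ∷_) [] as ≡ map (g i) as
    foldr-map i []       = refl
    foldr-map i (a ∷ as) = cong (g i a ∷_) (foldr-map i as)

  module _ {p : ∀ i → A i → Bool} (P : inp ▹ enc ⊢ (λ (i , a) → p i a) ∶ bool) where

    filtering : inp ⊢ (λ i → filterᵇ (p i) (l i)) ∶ list enc
    filtering = by (λ i → foldr-filterᵇ i (l i))
      (fold L (λ i a as → if p i a then a ∷ as else as) nil′
        (if (withItem (list enc) P) (cons′ (item {inp = inp} (list enc)) (accumulator {inp = inp} {enc = enc} (list enc)))
                                    (accumulator {inp = inp} {enc = enc} (list enc)))
        arg bound)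
      where
      foldr-filterᵇ : ∀ i as → foldr (λ a as → if p i a then a ∷ as else as) [] as ≡ filterᵇ (p i) as
      foldr-filterᵇ i []       = refl
      foldr-filterᵇ i (a ∷ as) with p i a
      ... | true  = cong (a ∷_) (foldr-filterᵇ i as)
      ... | false = foldr-filterᵇ i as

      bound : Additive {inp = inp} enc (list enc) (λ i a as → if p i a then a ∷ as else as) arg
      bound i a as with p i a
      ... | true  = additive-∷ (size (enc i a)) _ (ℕ.m≤n+m _ _)
      ... | false = ℕ.m≤m+n _ _

    private
      foldr-map : ∀ {A : Set} (f : Bool → Bool → Bool) z (p : A → Bool) as →
                  foldr (λ a b → f (p a) b) z as ≡ foldr f z (map p as)
      foldr-map f z p []       = refl
      foldr-map f z p (a ∷ as) = cong (f (p a)) (foldr-map f z p as)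

      bounded : (f : Bool → Bool → Bool) → Additive {inp = inp} enc bool (λ i a b → f (p i a) b) (con 3)
      bounded f i a b = ℕ.≤-trans (size-encodeBool (f (p i a) b)) (ℕ.m≤n+m 3 _)

    exists : inp ⊢ (λ i → any (p i) (l i)) ∶ bool
    exists = by (λ i → foldr-map _∨_ false (p i) (l i))
      (fold L (λ i a b → p i a ∨ b) never (or (withItem bool P) (accumulator {inp = inp} {enc = enc} bool)) (con 3) (bounded _∨_))

    forAll : inp ⊢ (λ i → all (p i) (l i)) ∶ bool
    forAll = by (λ i → foldr-map _∧_ true (p i) (l i))
      (fold L (λ i a b → p i a ∧ b) always (and (withItem bool P) (accumulator {inp = inp} {enc = enc} bool)) (con 3) (bounded _∧_))

-- Unary numbers

units : ℕ → List ⊤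
units n = replicate n tt

-- As a list of units, a number can drive a loop like any other list. This is affordable for numbers
-- of vertices and their indices, which are bounded by the size of the graph.
encodeUnary : ℕ → Tree
encodeUnary n = encodeList (λ _ → nil) (units n)

unary : I → ℕ → Tree
unary _ = encodeUnary

size-unary-mono : ∀ {m n} → m ≤ n → size (encodeUnary m) ≤ size (encodeUnary n)
size-unary-mono {n = zero}  z≤n       = ℕ.≤-refl
size-unary-mono {n = suc n} z≤n       = s≤s z≤n
size-unary-mono             (s≤s m≤n) = s≤s (s≤s (size-unary-mono m≤n))

isCons-unary-∸ : ∀ m n → isCons (encodeUnary (n ∸ m)) ≡ (m <ᵇ n)
isCons-unary-∸ zero    zero    = refl
isCons-unary-∸ zero    (suc n) = refl
isCons-unary-∸ (suc m) zero    = refl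
isCons-unary-∸ (suc m) (suc n) = isCons-unary-∸ m n

≡ᵇ-from-<ᵇ : ∀ m n → (not (m <ᵇ n) ∧ not (n <ᵇ m)) ≡ (m ≡ᵇ n)
≡ᵇ-from-<ᵇ zero    zero    = refl
≡ᵇ-from-<ᵇ zero    (suc n) = refl
≡ᵇ-from-<ᵇ (suc m) zero    = refl
≡ᵇ-from-<ᵇ (suc m) (suc n) = ≡ᵇ-from-<ᵇ m n

asUnits : {m : I → ℕ} → inp ⊢ m ∶ unary → inp ⊢ (λ i → units (m i)) ∶ list (λ _ _ → nil)
asUnits = recode (λ _ → refl)

predecessor : {m : I → ℕ} → inp ⊢ m ∶ unary → inp ⊢ (λ i → pred (m i)) ∶ unary
predecessor {m = m} ⟪ M ⟫ = ⟪ cast (λ i → eq (m i)) (tailR M) ⟫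
  where
  eq : ∀ m → tail (encodeUnary m) ≡ encodeUnary (pred m)
  eq zero    = refl
  eq (suc m) = refl

successor : {m : I → ℕ} → inp ⊢ m ∶ unary → inp ⊢ (λ i → suc (m i)) ∶ unary
successor ⟪ M ⟫ = ⟪ consR (const nil) M ⟫

minus : {m n : I → ℕ} → inp ⊢ m ∶ unary → inp ⊢ n ∶ unary → inp ⊢ (λ i → m i ∸ n i) ∶ unary
minus {inp = inp} {m} {n} M N = by (λ i → eq (m i) (n i))
  (fold (asUnits N) (λ _ _ → pred) M (predecessor (accumulator {inp = inp} unary)) (con 0)
    (λ i _ k → ℕ.m≤n⇒m≤n+o 0 (size-unary-mono (ℕ.pred[n]≤n {k}))))
  where
  eq : ∀ m n → foldr (λ _ → pred) m (units n) ≡ m ∸ n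
  eq m zero    = refl
  eq m (suc n) = trans (cong pred (eq m n)) (ℕ.pred[m∸n]≡m∸[1+n] m n)

less : {m n : I → ℕ} → inp ⊢ m ∶ unary → inp ⊢ n ∶ unary → inp ⊢ (λ i → m i <ᵇ n i) ∶ bool
less {m = m} {n} M N = by (λ i → isCons-unary-∸ (m i) (n i)) ⟪ isConsR (minus N M .program) ⟫

equal : {m n : I → ℕ} → inp ⊢ m ∶ unary → inp ⊢ n ∶ unary → inp ⊢ (λ i → m i ≡ᵇ n i) ∶ bool
equal {m = m} {n} M N = by (λ i → ≡ᵇ-from-<ᵇ (m i) (n i)) (and (not′ (less M N)) (not′ (less N M)))

lengthOf : {enc : ∀ i → A i → Tree} {l : ∀ i → List (A i)} →
           inp ⊢ l ∶ list enc → inp ⊢ (λ i → length (l i)) ∶ unary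
lengthOf {l = l} L = recode (λ i → cong (encodeList (λ _ → nil)) (eq (l i)))
                            (mapping L {encB = λ _ _ → nil} {g = λ _ _ → tt} ⟪ const nil ⟫)
  where
  eq : ∀ {A : Set} (as : List A) → map (λ _ → tt) as ≡ units (length as)
  eq []       = refl
  eq (a ∷ as) = cong (tt ∷_) (eq as)

-- The index drives a loop that takes tails. Its accumulator is a raw tree, since only the final
-- head needs to be understood as the code of a value.
entry : {n : I → ℕ} {enc : ∀ i → A i → Tree} {f : ∀ i → Fin (n i) → A i} {u : ∀ i → Fin (n i)} →
        inp ⊢ (λ i → tabulate (f i)) ∶ list enc → inp ⊢ (λ i → toℕ (u i)) ∶ unary → inp ⊢ (λ i → f i (u i)) ∶ enc
entry {inp = inp} {enc = enc} {f} {u} ⟪ L ⟫ U = recode (λ i → eq (enc i) (f i) (u i))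
  (headOf (fold (asUnits U) {encB = raw} (λ _ _ → tail) ⟪ L ⟫ (tailOf (accumulator {inp = inp} raw)) (con 0)
    (λ i _ t → ℕ.m≤n⇒m≤n+o 0 (size-tail t))))
  where
  tails : Tree → ℕ → Tree
  tails t k = foldr (λ _ → tail) t (units k)

  tails-tail : ∀ t k → tails (tail t) k ≡ tail (tails t k)
  tails-tail t zero    = refl
  tails-tail t (suc k) = cong tail (tails-tail t k)

  eq : ∀ {A : Set} (enc : A → Tree) {n} (f : Fin n → A) u →
       head (tails (encodeList enc (tabulate f)) (toℕ u)) ≡ enc (f u)
  eq enc f zero    = refl
  eq enc f (suc u) = trans (cong head (sym (tails-tail (encodeList enc (tabulate f)) (toℕ u)))) (eq enc (f ∘ suc) u)

-- The flag is the parity of the units read so far and `h` is half their number, which every second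
-- unit increases.
halfStep : Bool × ℕ → Bool × ℕ
halfStep (odd , h) = not odd , (if odd then suc h else h)

foldr-halfStep : ∀ m → foldr (λ _ → halfStep) (false , 0) (units (suc (suc m))) ≡
                       (let odd , h = foldr (λ _ → halfStep) (false , 0) (units m) in odd , suc h)
foldr-halfStep m with foldr (λ _ → halfStep) (false , 0) (units m)
... | true  , h = refl
... | false , h = refl

foldr-half : ∀ m → proj₂ (foldr (λ _ → halfStep) (false , 0) (units m)) ≡ ⌊ m /2⌋
foldr-half zero          = refl
foldr-half (suc zero)    = refl
foldr-half (suc (suc m)) = trans (cong proj₂ (foldr-halfStep m)) (cong suc (foldr-half m))

half : {m : I → ℕ} → inp ⊢ m ∶ unary → inp ⊢ (λ i → ⌊ m i /2⌋) ∶ unary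
half {I = I} {inp = inp} {m} M = by (λ i → foldr-half (m i))
  (snd (fold (asUnits M) (λ _ _ → halfStep) (pair never (recode (λ _ → refl) never))
    (pair (not′ (fst state)) (if (fst state) (successor (snd state)) (snd state)))
    (con 4) (λ i _ → bound)))
  where
  state = accumulator {inp = inp} {enc = λ _ (_ : ⊤) → nil} (encodePair I bool unary)

  encodeState : Bool × ℕ → Tree
  encodeState (b , h) = cons (encodeBool b) (encodeUnary h)

  bound : ∀ s → size (encodeState (halfStep s)) ≤ size (encodeState s) + 4
  bound (true  , h) = ℕ.m≤m+n _ 4
  bound (false , h) = ℕ.≤-trans (ℕ.≤-reflexive (cong (2 +_) (ℕ.+-comm 2 (size (encodeUnary h)))))
                                (ℕ.+-monoʳ-≤ (2 + size (encodeUnary h)) (ℕ.m≤m+n 2 2))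

-- Binary numbers

nat : I → ℕ → Tree
nat _ = encodeℕ

bits : ℕᵇ → List Bool
bits ℕᵇ.zero  = []
bits 2[1+ b ] = false ∷ bits b
bits 1+[2 b ] = true ∷ bits b

fromBits : List Bool → ℕᵇ
fromBits []           = ℕᵇ.zero
fromBits (false ∷ bs) = 2[1+ fromBits bs ]
fromBits (true ∷ bs)  = 1+[2 fromBits bs ]

fromBits-bits : ∀ b → fromBits (bits b) ≡ b
fromBits-bits ℕᵇ.zero  = refl
fromBits-bits 2[1+ b ] = cong 2[1+_] (fromBits-bits b)
fromBits-bits 1+[2 b ] = cong 1+[2_] (fromBits-bits b)

encodeℕᵇ-bits : ∀ b → encodeℕᵇ b ≡ encodeList encodeBool (bits b)
encodeℕᵇ-bits ℕᵇ.zero  = refl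
encodeℕᵇ-bits 2[1+ b ] = cong (cons nil) (encodeℕᵇ-bits b)
encodeℕᵇ-bits 1+[2 b ] = cong (cons (cons nil nil)) (encodeℕᵇ-bits b)

-- `prependBit` is what `ℕᵇ.toℕ` does at the two nonzero constructors, and in bijective binary no
-- number has a second representation.
encodeℕ-prependBit : ∀ b c → encodeℕ (prependBit b c) ≡ cons (encodeBool b) (encodeℕ c)
encodeℕ-prependBit true  c = cong encodeℕᵇ (trans
  (cong (λ k → ℕᵇ.fromℕ (suc (2 * k))) (sym (ℕᵇ.toℕ-fromℕ c))) (ℕᵇ.fromℕ-toℕ 1+[2 ℕᵇ.fromℕ c ]))
encodeℕ-prependBit false c = cong encodeℕᵇ (trans
  (cong (λ k → ℕᵇ.fromℕ (2 * suc k)) (sym (ℕᵇ.toℕ-fromℕ c))) (ℕᵇ.fromℕ-toℕ 2[1+ ℕᵇ.fromℕ c ]))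

bitsOf : {m : I → ℕ} → inp ⊢ m ∶ nat → inp ⊢ (λ i → bits (ℕᵇ.fromℕ (m i))) ∶ list bool
bitsOf {m = m} = recode (λ i → encodeℕᵇ-bits (ℕᵇ.fromℕ (m i)))

prepend : {b : I → Bool} {m : I → ℕ} → inp ⊢ b ∶ bool → inp ⊢ m ∶ nat →
          inp ⊢ (λ i → prependBit (b i) (m i)) ∶ nat
prepend {I = I} {b = b} {m} F G =
  recode {encA = encodePair I bool nat} (λ i → sym (encodeℕ-prependBit (b i) (m i))) (pair F G)

-- Reading k from its least significant bit, subtract the digit, 1 or 2, from
-- m and halve both: k = d + 2k′ is at most m iff d ≤ m and k′ ≤ (m - d) / 2.
atMostStep : Bool → Bool × ℕ → Bool × ℕ
atMostStep d (ok , m) =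
  -- The bit true stands for the digit 1 and false for 2, so `e` is the digit minus one. A strict
  -- comparison with `e` thus tests whether the digit is at most m, and `pred` completes the
  -- subtraction.
  let e = if d then 0 else 1 in ok ∧ (e <ᵇ m) , ⌊ pred (m ∸ e) /2⌋

foldl-atMostStep : ∀ b ok m → proj₁ (foldl (flip atMostStep) (ok , m) (bits b)) ≡ ok ∧ (ℕᵇ.toℕ b <ᵇ suc m)
foldl-atMostStep ℕᵇ.zero  ok m = sym (Bool.∧-identityʳ ok)
foldl-atMostStep 2[1+ b ] ok m = trans (foldl-atMostStep b _ _)
  (trans (Bool.∧-assoc ok _ _) (cong (ok ∧_) (eq m)))
  where
  eq : ∀ m → (1 <ᵇ m) ∧ (ℕᵇ.toℕ b <ᵇ suc ⌊ pred (m ∸ 1) /2⌋) ≡ (2 * suc (ℕᵇ.toℕ b) <ᵇ suc m)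
  eq m rewrite ℕ.+-suc (ℕᵇ.toℕ b) (ℕᵇ.toℕ b + 0) with m
  ... | 0           = refl
  ... | 1           = refl
  ... | suc (suc m) = <ᵇ-⌊/2⌋ (ℕᵇ.toℕ b) m
foldl-atMostStep 1+[2 b ] ok m = trans (foldl-atMostStep b _ _)
  (trans (Bool.∧-assoc ok _ _) (cong (ok ∧_) (eq m)))
  where
  eq : ∀ m → (0 <ᵇ m) ∧ (ℕᵇ.toℕ b <ᵇ suc ⌊ pred m /2⌋) ≡ (suc (2 * ℕᵇ.toℕ b) <ᵇ suc m)
  eq 0       = refl
  eq (suc m) = <ᵇ-⌊/2⌋ (ℕᵇ.toℕ b) m

atMost : {k m : I → ℕ} → inp ⊢ k ∶ nat → inp ⊢ m ∶ unary → inp ⊢ (λ i → k i <ᵇ suc (m i)) ∶ bool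
atMost {I = I} {inp = inp} {k} {m} K M = by
  (λ i → trans (foldl-atMostStep (ℕᵇ.fromℕ (k i)) true (m i)) (cong (_<ᵇ suc (m i)) (ℕᵇ.toℕ-fromℕ (k i))))
  (fst (foldFromLeft (bitsOf K) (λ _ → atMostStep) (pair always M)
    (pair (and (fst state) (less digit (snd state))) (half (predecessor (minus (snd state) digit))))
    (con 2) (λ i → bound)))
  where
  states = encodePair I bool unary
  state  = accumulator {inp = inp} {enc = bool} states
  digit  = if {enc = unary} (item {inp = inp} {enc = bool} states) ⟪ const nil ⟫ ⟪ const (cons nil nil) ⟫

  encodeState : Bool × ℕ → Tree
  encodeState (b , h) = cons (encodeBool b) (encodeUnary h)

  bound : ∀ d s → size (encodeState (atMostStep d s)) ≤ size (encodeState s) + 2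
  bound d (ok , m) = s≤s (ℕ.≤-trans
    (ℕ.+-mono-≤ (ℕ.≤-trans (size-encodeBool (proj₁ (atMostStep d (ok , m)))) (ℕ.+-monoˡ-≤ 2 (size-positive ok)))
                (size-unary-mono smaller))
    (ℕ.≤-reflexive (trans (ℕ.+-assoc (size (encodeBool ok)) 2 _)
      (trans (cong (size (encodeBool ok) +_) (ℕ.+-comm 2 (size (encodeUnary m)))) (sym (ℕ.+-assoc (size (encodeBool ok)) _ 2))))))
    where
    size-positive : ∀ b → 1 ≤ size (encodeBool b)
    size-positive false = s≤s z≤n
    size-positive true  = s≤s z≤n

    smaller : proj₂ (atMostStep d (ok , m)) ≤ m
    smaller = ℕ.≤-trans (ℕ.⌊n/2⌋≤n _) (ℕ.≤-trans (ℕ.pred[n]≤n {m ∸ e}) (ℕ.m∸n≤m m e))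
      where e = if d then 0 else 1

nonEmpty first : List Bool → Bool
nonEmpty []       = false
nonEmpty (_ ∷ _)  = true
first    []       = false
first    (b ∷ _)  = b

-- Whole trees cannot be compared in one step, so colors are compared digit by digit. The loop runs
-- over the first number and uses up the second, of which nothing may be left in the end.
sameStep : Bool → Bool × List Bool → Bool × List Bool
sameStep b (ok , bs) = ok ∧ (nonEmpty bs ∧ agree b (first bs)) , drop 1 bs

foldl-sameStep : ∀ as ok bs → let ok′ , rest = foldl (flip sameStep) (ok , bs) as in
                 ok′ ∧ not (nonEmpty rest) ≡ ok ∧ does (List.≡-dec Bool._≟_ as bs)
foldl-sameStep []       ok []       = refl
foldl-sameStep []       ok (b ∷ bs) = refl
foldl-sameStep (a ∷ as) ok []       = trans (foldl-sameStep as (ok ∧ false) []) (Bool.∧-assoc ok false _)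
foldl-sameStep (a ∷ as) ok (b ∷ bs) = trans (foldl-sameStep as (ok ∧ agree a b) bs)
  (trans (Bool.∧-assoc ok (agree a b) _) (cong (λ c → ok ∧ (c ∧ does (List.≡-dec Bool._≟_ as bs))) (agree-≟ a b)))
  where
  agree-≟ : ∀ a b → agree a b ≡ does (a Bool.≟ b)
  agree-≟ true  true  = refl
  agree-≟ true  false = refl
  agree-≟ false true  = refl
  agree-≟ false false = refl

same : {m n : I → ℕ} → inp ⊢ m ∶ nat → inp ⊢ n ∶ nat → inp ⊢ (λ i → m i ≡ᵇ n i) ∶ bool
same {I = I} {inp = inp} {m} {n} M N = by (λ i → trans (foldl-sameStep (bits (ℕᵇ.fromℕ (m i))) true (bits (ℕᵇ.fromℕ (n i)))) (sameBits (m i) (n i)))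
  (and (fst result) (not′ (nonEmptyOf (snd result))))
  where
  sameBits : ∀ m n → does (List.≡-dec Bool._≟_ (bits (ℕᵇ.fromℕ m)) (bits (ℕᵇ.fromℕ n))) ≡ (m ≡ᵇ n)
  sameBits m n = does-⇔ (mk⇔
    (λ eq → trans (sym (ℕᵇ.toℕ-fromℕ m)) (trans (cong ℕᵇ.toℕ (trans (sym (fromBits-bits (ℕᵇ.fromℕ m)))
              (trans (cong fromBits eq) (fromBits-bits (ℕᵇ.fromℕ n))))) (ℕᵇ.toℕ-fromℕ n)))
    (cong (λ k → bits (ℕᵇ.fromℕ k)))) (List.≡-dec Bool._≟_ _ _) (m ℕ.≟ n)

  nonEmptyOf : {I : Set} {inp : I → Tree} {l : I → List Bool} → inp ⊢ l ∶ list bool → inp ⊢ (λ i → nonEmpty (l i)) ∶ bool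
  nonEmptyOf {l = l} ⟪ L ⟫ = by (λ i → eq (l i)) ⟪ isConsR L ⟫
    where
    eq : ∀ bs → isCons (encodeList encodeBool bs) ≡ nonEmpty bs
    eq []      = refl
    eq (_ ∷ _) = refl

  firstOf : {I : Set} {inp : I → Tree} {l : I → List Bool} → inp ⊢ l ∶ list bool → inp ⊢ (λ i → first (l i)) ∶ bool
  firstOf {l = l} ⟪ L ⟫ = ⟪ cast (λ i → eq (l i)) (headR L) ⟫
    where
    eq : ∀ bs → head (encodeList encodeBool bs) ≡ encodeBool (first bs)
    eq []      = refl
    eq (_ ∷ _) = refl

  tail-drop : ∀ bs → tail (encodeList encodeBool bs) ≡ encodeList encodeBool (drop 1 bs)
  tail-drop []      = refl
  tail-drop (_ ∷ _) = refl

  restOf : {I : Set} {inp : I → Tree} {l : I → List Bool} → inp ⊢ l ∶ list bool → inp ⊢ (λ i → drop 1 (l i)) ∶ list bool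
  restOf {l = l} ⟪ L ⟫ = ⟪ cast (λ i → tail-drop (l i)) (tailR L) ⟫

  states = encodePair I bool (list bool)
  state  = accumulator {inp = inp} {enc = bool} states

  bound : Additive {inp = inp} bool states (λ _ → sameStep) (con 3)
  bound i b (ok , bs) = ℕ.≤-trans
    (s≤s (ℕ.+-mono-≤ (size-encodeBool (proj₁ (sameStep b (ok , bs))))
      (ℕ.≤-trans (ℕ.≤-reflexive (cong size (sym (tail-drop bs)))) (size-tail (encodeList encodeBool bs)))))
    (ℕ.≤-trans (ℕ.≤-reflexive (ℕ.+-comm 4 (size (encodeList encodeBool bs))))
      (ℕ.≤-trans (ℕ.≤-reflexive (ℕ.+-suc _ 3)) (ℕ.+-monoˡ-≤ 3 (s≤s (ℕ.m≤n+m _ _)))))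

  result = foldFromLeft (bitsOf M) (λ _ → sameStep) (pair always (bitsOf N))
    (pair (and (fst state) (and (nonEmptyOf (snd state))
                                (agreeing (item {inp = inp} {enc = bool} states) (firstOf (snd state)))))
          (restOf (snd state))) (con 3) bound

-- Enumeration of the vertices

vertex : (n : I → ℕ) → ∀ i → Fin (n i) → Tree
vertex n i v = encodeUnary (toℕ v)

module _ {I : Set} {inp : I → Tree} {n : I → ℕ} where

  -- The counter is kept below n to bound the growth of the accumulator.
  private
    Counter : I → Set
    Counter i = Σ[ c ∈ ℕ ] c ≤ n i

    count : ∀ i → Counter i × List ℕ → Counter i × List ℕ
    count i ((c , c≤n) , cs) = (pred c , ℕ.≤-trans ℕ.pred[n]≤n c≤n) , pred c ∷ cs

    range : ℕ → ℕ → List ℕ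
    range c zero    = []
    range c (suc m) = c ∷ range (suc c) m

    foldr-count : ∀ i c m s → proj₁ s ≡ c + m →
                  let (c′ , _) , cs = foldr (λ _ → count i) (s , []) (units m) in
                  c′ ≡ c × cs ≡ range c m
    foldr-count i c zero    s eq = trans eq (ℕ.+-identityʳ c) , refl
    foldr-count i c (suc m) s eq =
      let c′≡ , cs≡ = foldr-count i (suc c) m s (trans eq (ℕ.+-suc c m))
      in cong pred c′≡ , cong₂ _∷_ (cong pred c′≡) cs≡

    range-tabulate : ∀ c m → range c m ≡ tabulate {n = m} (λ u → c + toℕ u)
    range-tabulate c zero    = refl
    range-tabulate c (suc m) = cong₂ _∷_ (sym (ℕ.+-identityʳ c))
      (trans (range-tabulate (suc c) m) (List.tabulate-cong (λ u → sym (ℕ.+-suc c (toℕ u)))))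

    encodeList-map : ∀ {A B : Set} (enc : B → Tree) (g : A → B) as →
                     encodeList enc (map g as) ≡ encodeList (λ a → enc (g a)) as
    encodeList-map enc g []       = refl
    encodeList-map enc g (a ∷ as) = cong (cons _) (encodeList-map enc g as)

  -- Counting down from n while prepending puts the numbers into increasing order, as in `allFin`.
  vertices : inp ⊢ n ∶ unary → inp ⊢ (λ i → allFin (n i)) ∶ list (vertex n)
  vertices N = recode (λ i → trans (cong (encodeList encodeUnary) (eq i)) (encodeList-map encodeUnary toℕ (allFin (n i))))
    (snd (fold (asUnits N) (λ i _ → count i)
      (pair {a = λ i → n i , ℕ.≤-refl} (recode (λ _ → refl) N) nil′)
      (pair (recode (λ _ → refl) down) (cons′ down (snd state)))
      (con 1 ⊕ N .program .space) bound))
    where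
    counter : ∀ i → Counter i → Tree
    counter i (c , _) = encodeUnary c

    states = encodePair I counter (list unary)
    state  = accumulator {inp = inp} {enc = λ _ (_ : ⊤) → nil} states

    down = predecessor {m = λ (i , _ , (c , _) , _) → c} (recode (λ _ → refl) (fst state))

    eq : ∀ i → proj₂ (foldr (λ _ → count i) ((n i , ℕ.≤-refl) , []) (units (n i))) ≡ map toℕ (allFin (n i))
    eq i = trans (proj₂ (foldr-count i 0 (n i) (n i , ℕ.≤-refl) refl))
                 (trans (range-tabulate 0 (n i)) (sym (List.map-tabulate (λ u → u) toℕ)))

    bound : Additive {inp = inp} (λ _ _ → nil) states (λ i _ → count i) (con 1 ⊕ N .program .space)
    bound i _ ((c , c≤n) , cs) = s≤s (begin
      size (encodeUnary (pred c)) + suc (size (encodeUnary (pred c)) + size (encodeList encodeUnary cs))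
        ≤⟨ ℕ.+-mono-≤ (size-unary-mono (ℕ.pred[n]≤n {c})) (additive-∷ (size (encodeUnary (pred c))) _ small′) ⟩
      size (encodeUnary c) + (size (encodeList encodeUnary cs) + suc (⟦ N .program .space ⟧ (size (cons (inp i) nil))))
        ≡⟨ ℕ.+-assoc (size (encodeUnary c)) _ _ ⟨
      size (encodeUnary c) + size (encodeList encodeUnary cs) + suc (⟦ N .program .space ⟧ (size (cons (inp i) nil))) ∎)
      where
      open ℕ.≤-Reasoning
      small′ : size (encodeUnary (pred c)) ≤ ⟦ N .program .space ⟧ (size (cons (inp i) nil))
      small′ = ℕ.≤-trans (size-unary-mono (ℕ.≤-trans (ℕ.pred[n]≤n {c}) c≤n))
        (ℕ.≤-trans (N .program .small i) (⟦⟧-mono (N .program .space) (size-head (cons (inp i) nil))))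

-- Computing the kernel

instanceCode : {I : Set} → I → Instance → Tree
instanceCode _ = encode

module _ {I : Set} {inp : I → Tree} {G : I → Instance} (instance′ : inp ⊢ G ∶ instanceCode) where

  private
    n : I → ℕ
    n i = order (G i)

    X : ∀ i → ColoredGraph (n i)
    X i = graph (G i)

    components : inp ⊢ (λ i → encode (G i)) ∶ raw
    components = recode (λ _ → refl) instance′

  paramOf : inp ⊢ (λ i → param (G i)) ∶ nat
  paramOf = recode (λ _ → refl) (headOf components)

  colorsOf : inp ⊢ (λ i → tabulate (color (X i))) ∶ list nat
  colorsOf = recode (λ _ → refl) (headOf (tailOf components))

  matrixOf : inp ⊢ (λ i → tabulate (λ u → tabulate (adj (X i) u))) ∶ list (list bool)
  matrixOf = recode (λ _ → refl) (tailOf (tailOf components))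

  -- The number of vertices is no component of the code of an instance; it is recovered as the
  -- length of the list of colors.
  verticesOf : inp ⊢ (λ i → allFin (n i)) ∶ list (vertex n)
  verticesOf = vertices (by (λ i → List.length-tabulate (color (X i))) (lengthOf colorsOf))

  module _ {u : ∀ i → Fin (n i)} (U : inp ⊢ u ∶ vertex n) where

    index : inp ⊢ (λ i → toℕ (u i)) ∶ unary
    index = recode (λ _ → refl) U

    colorOf : inp ⊢ (λ i → color (X i) (u i)) ∶ nat
    colorOf = entry colorsOf index

  adjacent : {u v : ∀ i → Fin (n i)} → inp ⊢ u ∶ vertex n → inp ⊢ v ∶ vertex n →
             inp ⊢ (λ i → adj (X i) (u i) (v i)) ∶ bool
  adjacent U V = entry (entry matrixOf (index U)) (index V)

module _ {I : Set} {inp : I → Tree} {G : I → Instance} (instance′ : inp ⊢ G ∶ instanceCode)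
         {u v : ∀ i → Fin (order (G i))}
         (U : inp ⊢ u ∶ vertex (order ∘ G)) (V : inp ⊢ v ∶ vertex (order ∘ G)) where

  twins : inp ⊢ (λ i → areTwins (graph (G i)) (u i) (v i)) ∶ bool
  twins = and (same (colorOf instance′ U) (colorOf instance′ V))
    (forAll (verticesOf instance′)
      (or (equal (index instance″ W) (index instance″ U′))
          (or (equal (index instance″ W) (index instance″ V′))
              (agreeing (adjacent instance″ U′ W) (adjacent instance″ V′ W)))))
    where
    instance″ = outer {encB = vertex (order ∘ G)} instance′
    U′ = outer {encB = vertex (order ∘ G)} U
    V′ = outer {encB = vertex (order ∘ G)} V
    W = inner {inp = inp} {enc = vertex (order ∘ G)}

module _ {I : Set} {inp : I → Tree} {G : I → Instance} (instance′ : inp ⊢ G ∶ instanceCode)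
         {u : ∀ i → Fin (order (G i))} (U : inp ⊢ u ∶ vertex (order ∘ G)) where

  private
    instance″ = outer {encB = vertex (order ∘ G)} instance′
    U′ = outer {encB = vertex (order ∘ G)} U
    V = inner {inp = inp} {enc = vertex (order ∘ G)}

  keeping : inp ⊢ (λ i → isKept (graph (G i)) (u i)) ∶ bool
  keeping = not′ (exists (verticesOf instance′)
    (and (less (index instance″ U′) (index instance″ V)) (twins instance″ U′ V)))

module _ {I : Set} {inp : I → Tree} {G : I → Instance} (instance′ : inp ⊢ G ∶ instanceCode) where

  private
    instance″ = outer {encB = vertex (order ∘ G)} instance′
    V = inner {inp = inp} {enc = vertex (order ∘ G)}

  keptOf : inp ⊢ (λ i → kept (graph (G i))) ∶ list (vertex (order ∘ G))
  keptOf = filtering (verticesOf instance′) (keeping instance″ V)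

  recoloring : {u : ∀ i → Fin (order (G i))} → inp ⊢ u ∶ vertex (order ∘ G) →
               inp ⊢ (λ i → newColor (graph (G i)) (u i)) ∶ nat
  recoloring {u} U = fold (verticesOf instance′) {encB = nat} _ (colorOf instance′ U)
    (if (withItem nat (keeping instance″ V)) (accumulator {inp = inp} {enc = vertex (order ∘ G)} nat)
        (prepend (withItem nat (adjacent instance″ V (outer U))) (accumulator {inp = inp} {enc = vertex (order ∘ G)} nat)))
    -- A new digit costs one cons and a bit of size at most 3.
    (con 4) bound
    where
    bound : Additive {inp = inp} (vertex (order ∘ G)) nat
              (λ i v c → if isKept (graph (G i)) v then c else prependBit (adj (graph (G i)) v (u i)) c) (con 4)
    bound i v c with isKept (graph (G i)) v
    ... | true  = ℕ.m≤m+n _ 4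
    ... | false rewrite encodeℕ-prependBit (adj (graph (G i)) v (u i)) c =
      ℕ.≤-trans (s≤s (ℕ.+-monoˡ-≤ _ (size-encodeBool (adj (graph (G i)) v (u i))))) (ℕ.≤-reflexive (ℕ.+-comm 4 _))

reducing : encode ⊢ reduced ∶ instanceCode
reducing = recode {encA = encodePair Instance nat (encodePair Instance (list nat) (list (list bool)))}
  (λ I → cong (cons (encodeℕ (param I))) (cong₂ cons
    (cong (encodeList encodeℕ) (tabulated (kept (graph I)) (newColor (graph I))))
    (cong (encodeList (encodeList encodeBool)) (trans (tabulated (kept (graph I)) _)
       (List.tabulate-cong (λ u → tabulated (kept (graph I)) _))))))
  (pair (paramOf input) (pair
    (mapping (keptOf input) (recoloring (outer input) V))
    -- The kept vertices are computed afresh for every row, at the price of a polynomial factor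
    -- only.
    (mapping (keptOf input) (mapping (outer (keptOf input)) (adjacent (outer (outer input)) (outer V) inner)))))
  where
  input : encode ⊢ (λ J → J) ∶ instanceCode
  input = ⟪ identity ⟫
  V = inner {inp = encode} {enc = vertex order}

  tabulated : {A B : Set} (as : List A) (g : A → B) → map g as ≡ tabulate (g ∘ lookup as)
  tabulated as g = trans (cong (map g) (sym (List.tabulate-lookup as))) (List.map-tabulate (lookup as) g)

κ-polynomialTime : PolynomialTime encode encode κ
κ-polynomialTime = polynomialTime {encB = encode} {f = κ} (program
  (if {x = trivial} {enc = instanceCode} (atMost (paramOf input) (half (lengthOf (keptOf input))))
    -- This constant is the code of the trivial instance: the parameter 0, no colors and no rows.
    (recode {a = λ _ → cons nil (cons nil nil)} {encA = raw} {encB = instanceCode} (λ _ → refl)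
      ⟪ const (cons nil (cons nil nil)) ⟫)
    reducing))
  where
  input : encode ⊢ (λ J → J) ∶ instanceCode
  input = ⟪ identity ⟫

theorem5p1 : ∃[ κ ] Kernelization (λ k → 2 * k) κ × PolynomialTime encode encode κ
theorem5p1 = κ , κ-kernelization , κ-polynomialTime
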